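{- There is a constant $c>0$ such that for all sufficiently large $n$, the Boolean lattice $2^{[n]}$ has at least $2^{c\,2^{n}\log n/\sqrt{n}}$ different partitions into $\binom{n}{\lfloor n/2\rfloor}$ symmetric chains.
   Context: $2^{[n]}$ is the power set of $[n]=\{1,\dots,n\}$ ordered by inclusion. A chain $c_0\subset\dots\subset c_k$ in $2^{[n]}$ is symmetric if $|c_i|=(n-k)/2+i$ for $i=0,\dots,k$ (equivalently, it is skipless and satisfies $|c_i|+|c_{k-i}|=n$). -}

module Defs where

open import Data.Nat using (ℕ; zero; suc; _+_; _*_; _≤ᵇ_; _/_)
open import Data.Nat.Combinatorics using (_C_)
open import Data.Bool using (if_then_else_)
open import Data.Fin using (Fin; toℕ)
open import Data.Fin.Subset using (Subset; _⊆_; ∣_∣)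
open import Data.List using (List; length; concat; lookup)
open import Data.List.Membership.Propositional using (_∈_)
open import Data.List.Relation.Unary.Unique.Propositional using (Unique)
open import Data.Product using (Σ; _×_)
open import Function.Bundles using (_⇔_)
open import Relation.Binary.PropositionalEquality using (_≡_)

isqrtFrom : ℕ → ℕ → ℕ
isqrtFrom zero    n = zero
isqrtFrom (suc s) n = if (suc s * suc s) ≤ᵇ n then suc s else isqrtFrom s n

⌊√_⌋ : ℕ → ℕ
⌊√ n ⌋ = isqrtFrom n n

-- A chain c₀ ⊂ c₁ ⊂ … ⊂ c_k in 2^[n], represented as the list [c₀, …, c_k]
-- (so k + 1 = length).  It is symmetric iff c_i ⊆ c_{i+1} for consecutive
-- elements and |c_i| = (n - k)/2 + i for all i, written without division as
-- 2·|c_i| + k = n + 2·i (this forces k ≤ n, n - k even, and strict inclusions).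
IsChain : ∀ {n} → List (Subset n) → Set
IsChain {n} c =
  (i j : Fin (length c)) → suc (toℕ i) ≡ toℕ j → lookup c i ⊆ lookup c j

SymmetricChain : ∀ {n} → List (Subset n) → Set
SymmetricChain {n} c =
  Σ ℕ λ k → (length c ≡ suc k) × IsChain c ×
    ((i : Fin (length c)) → 2 * ∣ lookup c i ∣ + k ≡ n + 2 * toℕ i)

IsSymChainPartition : (n : ℕ) → List (List (Subset n)) → Set
IsSymChainPartition n P =
  ((c : List (Subset n)) → c ∈ P → SymmetricChain c) ×
  Unique (concat P) ×
  ((x : Subset n) → x ∈ concat P) ×
  (length P ≡ n C (n / 2))

SamePartition : ∀ {n} → List (List (Subset n)) → List (List (Subset n)) → Set
SamePartition {n} P Q = (c : List (Subset n)) → (c ∈ P) ⇔ (c ∈ Q)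

{-# OPTIONS --safe #-}

-- Multiply a symmetric chain decomposition of 2^[h] by one of 2^[n - h], with h = ⌊n/2⌋.  A product of chains
-- with a ≤ b elements is a grid of a × b points, and every such grid has at least a! decompositions into
-- symmetric chains: in the a middle columns the chains run straight; going outwards through the ranks, one of
-- the r + 1 surviving chains is closed (any of them), and the r others, in order, are extended by the r points
-- of the next lower rank and by their mirror images in the upper half.  Choosing independently in all grids gives
-- ∏ a! partitions.  As a! ≥ t^(a ∸ t) and ∑ a = N, the number n C ⌊n/2⌋ of chains, there are at least t^(N - t G)
-- of them, where G is the number of grids.  G is of order 2^n / n and N of order 2^n / √n, so t may be taken
-- a power n^ε with t G ≤ N / 2.
module Submission where

open import Defs
open import Data.Bool using (true; false; T)
open import Data.Nat
open import Data.Nat.Properties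
open import Data.Nat.Combinatorics using (_C_; nCk+nC[k+1]≡[n+1]C[k+1]; nCn≡1; nCk≡nC[n∸k])
open import Data.Nat.DivMod using (m/n*n≤m; m≡m%n+[m/n]*n; m%n<n; m/n≤m; m≥n⇒m/n>0)
open import Data.Nat.Induction using (<-rec)
open import Data.Nat.ListAction using (sum; product)
open import Data.Nat.Logarithm using (⌊log₂_⌋; ⌊log₂⌋-mono-≤; ⌊log₂⌊n/2⌋⌋≡⌊log₂n⌋∸1; ⌊log₂[2^n]⌋≡n)
open import Data.Nat.Tactic.RingSolver using (solve-∀)
open import Data.Fin using (Fin; zero; suc; toℕ; punchIn; remQuot; combine; fromℕ<)
open import Data.Fin.Properties using (combine-remQuot; punchIn-injective; toℕ-injective; toℕ<n; toℕ-fromℕ<)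
open import Data.Fin.Subset using (Subset; inside; outside; _⊆_; ∣_∣)
open import Data.Fin.Subset.Properties using (s⊆s; drop-∷-⊆)
open import Data.Vec using ([]; _∷_; take; drop) renaming (_++_ to _⊹_; here to hereᵛ; there to thereᵛ)
open import Data.Vec.Properties using (take++drop≡id; ++-injective)
open import Data.List using (List; []; _∷_; _∷ʳ_; _++_; length; concat; concatMap; map; tabulate; applyUpTo; cartesianProductWith; filter; lookup)
open import Data.List.Properties using (length-++; ++-assoc; ∷ʳ-injectiveˡ; ∷-injectiveʳ; ∷-injectiveˡ; concat-++; concatMap-++; length-applyUpTo; length-map; filter-++; filter-accept; filter-reject)
open import Data.List.Membership.Propositional using (_∈_)
open import Data.List.Membership.Propositional.Properties
open import Data.List.Relation.Unary.All using ([])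
open import Data.List.Relation.Unary.AllPairs using ([]; _∷_)
open import Data.List.Relation.Unary.Any using (here; there)
open import Data.List.Relation.Unary.Unique.Propositional using (Unique)
open import Data.List.Relation.Unary.Unique.Propositional.Properties using (Unique[x∷xs]⇒x∉xs)
  renaming (map⁺ to unique-map⁺; ++⁺ to unique-++⁺)
open import Data.List.Relation.Binary.Subset.Propositional using () renaming (_⊆_ to _⊑_)
open import Data.List.Relation.Binary.Permutation.Propositional using (_↭_; prep; ↭-refl; ↭-sym; ↭-trans; ↭⇒↭ₛ; module PermutationReasoning)
open import Data.List.Relation.Binary.Permutation.Propositional.Properties using (++⁺; ++⁺ˡ; ++⁺ʳ; shift; shifts; ∷↭∷ʳ; ++-comm; ∈-resp-↭; ↭-length; filter-↭)
import Data.List.Relation.Binary.Permutation.Setoid.Properties as Permutationₛ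
open import Data.Product using (Σ; ∃; ∃-syntax; ∃₂; _×_; _,_; proj₁; proj₂; uncurry)
open import Data.Sum using (_⊎_; inj₁; inj₂)
open import Function using (_∘_)
open import Function.Bundles using (Equivalence)
open import Relation.Binary.PropositionalEquality hiding ([_])
open import Relation.Nullary using (¬_; contradiction; yes; no)

-- Threading the ranks of a grid

-- Halving [n] is what makes the grids wide. A split into h and n - h elements gives about 2^n / √(h
-- (n - h)) grids, fewest for h near n/2; the average width N / G is then of order √n, so that log
-- (a !) is typically of order a log n and the exponents add up to N log n. The widths enter only
-- through their sum and their number; the bound by powers of `t` makes this information enough.
-- That the points of the grids are pairwise distinct is obtained by counting: the grids together
-- list 2^n entries and every subset is among them, so none is repeated. The equality ∑ a = N is a
-- double count too, since each symmetric chain meets the middle rank exactly once.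

data Run {E : Set} (R : E → E → Set) : E → E → List E → Set where
  [_] : ∀ x → Run R x x (x ∷ [])
  _∷_ : ∀ {x y z c} → R x y → Run R y z c → Run R x z (x ∷ c)

module _ {E : Set} {R : E → E → Set} where

  snoc : ∀ {x y z c} → Run R x y c → R y z → Run R x z (c ∷ʳ z)
  snoc [ x ]   s = s ∷ [ _ ]
  snoc (r ∷ w) s = r ∷ snoc w s

  run-applyUpTo : (f : ℕ → E) (e : ℕ) → (∀ t → t < e → R (f t) (f (suc t))) →
    Run R (f 0) (f e) (applyUpTo f (suc e))
  run-applyUpTo f zero    s = [ _ ]
  run-applyUpTo f (suc e) s = s 0 z<s ∷ run-applyUpTo (f ∘ suc) e (λ t t<e → s (suc t) (s<s t<e))

-- As `j` runs through `Fin s`, the pairs (`toℕ j` , `height j`) run through the points with x + y =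
-- s - 1, so that `Fin s` indexes one whole rank in the lower corner of a grid.
height : ∀ {s} → Fin s → ℕ
height {suc s} zero = s
height (suc j)      = height j

toℕ+height : ∀ {s} (j : Fin s) → suc (toℕ j + height j) ≡ s
toℕ+height zero    = refl
toℕ+height (suc j) = cong suc (toℕ+height j)

-- The reason why any chain may be closed: a point (x , y) lies below both (x + 1 , y) and (x , y +
-- 1). Whichever point `o` of a rank is left out, the others, in order, sit above the points of the
-- next lower rank, to the right from `o` on and upwards before it.
punchIn-step : ∀ {s} (o : Fin (suc s)) (j : Fin s) →
  (toℕ (punchIn o j) ≡ suc (toℕ j) × height (punchIn o j) ≡ height j) ⊎
  (toℕ (punchIn o j) ≡ toℕ j × height (punchIn o j) ≡ suc (height j))
punchIn-step zero    j       = inj₁ (refl , refl)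
punchIn-step (suc o) zero    = inj₂ (refl , refl)
punchIn-step (suc o) (suc j) with punchIn-step o j
... | inj₁ (a , b) = inj₁ (cong suc a , b)
... | inj₂ (a , b) = inj₂ (cong suc a , b)

module Threading {E : Set} (lo hi : ℕ → ℕ → E) where

  extend : ∀ {s} → Fin s → List E → List E
  extend j c = lo (toℕ j) (height j) ∷ c ∷ʳ hi (toℕ j) (height j)

  -- The code `i` is a number in the factorial base: `(suc s) !` unfolds to `suc s * s !`, so
  -- `remQuot` reads off the chain to close now and the code of the later choices. `peel` receives
  -- the decoded pair, on which proofs can match.
  thread : ∀ s → Fin (s !) → (Fin s → List E) → List (List E)
  peel   : ∀ s → Fin (suc s) × Fin (s !) → (Fin (suc s) → List E) → List (List E)
  thread zero    i q = []
  thread (suc s) i q = peel s (remQuot (s !) i) q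
  peel s (o , i) q = q o ∷ thread s i (λ j → extend j (q (punchIn o j)))

  -- Off by one: `layer s` holds the points with x + y = s - 1 and their mirror images, and
  -- `layer 0` is empty.
  layer : ∀ s → List E
  layer s = concat (tabulate {n = s} λ j → lo (toℕ j) (height j) ∷ hi (toℕ j) (height j) ∷ [])

  layersBelow : ℕ → List E
  layersBelow zero    = []
  layersBelow (suc s) = layer s ++ layersBelow s

  length-thread : ∀ s i q → length (thread s i q) ≡ s
  length-thread zero    i q = refl
  length-thread (suc s) i q = cong suc (length-thread s _ _)

  module _ where
    open PermutationReasoning

    concat-remove : ∀ {s} (o : Fin (suc s)) (q : Fin (suc s) → List E) →
      concat (tabulate q) ↭ q o ++ concat (tabulate (q ∘ punchIn o))
    concat-remove         zero    q = ↭-refl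
    concat-remove {suc s} (suc o) q = begin
      q zero ++ concat (tabulate (q ∘ suc))
        ↭⟨ ++⁺ˡ (q zero) (concat-remove o (q ∘ suc)) ⟩
      q zero ++ q (suc o) ++ concat (tabulate (q ∘ suc ∘ punchIn o))
        ↭⟨ shifts (q zero) (q (suc o)) ⟩
      q (suc o) ++ q zero ++ concat (tabulate (q ∘ suc ∘ punchIn o)) ∎

    concat-zip : ∀ {s} (f g : Fin s → List E) →
      concat (tabulate (λ j → f j ++ g j)) ↭ concat (tabulate f) ++ concat (tabulate g)
    concat-zip {zero}  f g = ↭-refl
    concat-zip {suc s} f g = begin
      (f zero ++ g zero) ++ concat (tabulate (λ j → f (suc j) ++ g (suc j)))
        ↭⟨ ++⁺ˡ (f zero ++ g zero) (concat-zip (f ∘ suc) (g ∘ suc)) ⟩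
      (f zero ++ g zero) ++ F ++ G  ≡⟨ ++-assoc (f zero) (g zero) (F ++ G) ⟩
      f zero ++ g zero ++ F ++ G    ↭⟨ ++⁺ˡ (f zero) (shifts (g zero) F) ⟩
      f zero ++ F ++ g zero ++ G    ≡⟨ ++-assoc (f zero) F (g zero ++ G) ⟨
      (f zero ++ F) ++ g zero ++ G  ∎
      where
      F = concat (tabulate (f ∘ suc))
      G = concat (tabulate (g ∘ suc))

    concat-tabulate-↭ : ∀ {s} {f g : Fin s → List E} → (∀ j → f j ↭ g j) →
      concat (tabulate f) ↭ concat (tabulate g)
    concat-tabulate-↭ {zero}  h = ↭-refl
    concat-tabulate-↭ {suc s} h = ++⁺ (h zero) (concat-tabulate-↭ (h ∘ suc))

    concat-extend : ∀ {s} (q : Fin s → List E) →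
      concat (tabulate (λ j → extend j (q j))) ↭ layer s ++ concat (tabulate q)
    concat-extend q = ↭-trans
      (concat-tabulate-↭ λ j → prep _ (↭-sym (∷↭∷ʳ _ (q j))))
      (concat-zip (λ j → lo (toℕ j) (height j) ∷ hi (toℕ j) (height j) ∷ []) q)

    -- Each round uses up exactly one layer, whichever chain it closes. The right side is therefore
    -- free of `i`, which makes all choices partitions of the same points.
    concat-thread : ∀ s i q → concat (thread s i q) ↭ concat (tabulate q) ++ layersBelow s
    concat-thread zero    i q = ↭-refl
    concat-thread (suc s) i q = let (o , i′) = remQuot (s !) i ; Q = concat (tabulate (q ∘ punchIn o)) in begin
      q o ++ concat (thread s i′ _)
        ↭⟨ ++⁺ˡ (q o) (concat-thread s i′ _) ⟩
      q o ++ concat (tabulate (λ j → extend j (q (punchIn o j)))) ++ layersBelow s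
        ↭⟨ ++⁺ˡ (q o) (++⁺ʳ (layersBelow s) (concat-extend (q ∘ punchIn o))) ⟩
      q o ++ (layer s ++ Q) ++ layersBelow s
        ↭⟨ ++⁺ˡ (q o) (++⁺ʳ (layersBelow s) (++-comm (layer s) Q)) ⟩
      q o ++ (Q ++ layer s) ++ layersBelow s
        ≡⟨ cong (q o ++_) (++-assoc Q (layer s) (layersBelow s)) ⟩
      q o ++ Q ++ layer s ++ layersBelow s
        ≡⟨ ++-assoc (q o) Q (layer s ++ layersBelow s) ⟨
      (q o ++ Q) ++ layer s ++ layersBelow s
        ↭⟨ ++⁺ʳ (layersBelow (suc s)) (↭-sym (concat-remove o q)) ⟩
      concat (tabulate q) ++ layer s ++ layersBelow s ∎

  length-layersBelow : ∀ s → length (layersBelow s) + s ≡ s * s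
  length-layersBelow zero    = refl
  length-layersBelow (suc s) = begin
    length (layer s ++ layersBelow s) + suc s        ≡⟨ cong (_+ suc s) (length-++ (layer s)) ⟩
    length (layer s) + length (layersBelow s) + suc s ≡⟨ cong (λ z → z + length (layersBelow s) + suc s) (length-layer s (λ j → toℕ j) height) ⟩
    s * 2 + length (layersBelow s) + suc s           ≡⟨ rearrange s (length (layersBelow s)) ⟩
    suc (s * 2) + (length (layersBelow s) + s)       ≡⟨ cong (suc (s * 2) +_) (length-layersBelow s) ⟩
    suc (s * 2) + s * s                              ≡⟨ rearrange₂ s ⟩
    suc s * suc s ∎
    where
    open ≡-Reasoning
    length-layer : ∀ s (x y : Fin s → ℕ) →
      length (concat (tabulate {n = s} λ j → lo (x j) (y j) ∷ hi (x j) (y j) ∷ [])) ≡ s * 2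
    length-layer zero    x y = refl
    length-layer (suc s) x y = cong (2 +_) (length-layer s (x ∘ suc) (y ∘ suc))
    rearrange : ∀ s l → s * 2 + l + suc s ≡ suc (s * 2) + (l + s)
    rearrange = solve-∀
    rearrange₂ : ∀ s → suc (s * 2) + s * s ≡ suc s * suc s
    rearrange₂ = solve-∀

  ∈-layer : ∀ x y → lo x y ∈ layer (suc (x + y)) × hi x y ∈ layer (suc (x + y))
  ∈-layer x y = go x y (λ i → i)
    where
    -- In the tail of the list `toℕ` is shifted by `suc` while `height` stays the same; the
    -- arbitrary `g` absorbs the shift.
    go : ∀ x y (g : ℕ → ℕ) → let L = concat (tabulate {n = suc (x + y)} λ j → lo (g (toℕ j)) (height j) ∷ hi (g (toℕ j)) (height j) ∷ []) in
      lo (g x) y ∈ L × hi (g x) y ∈ L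
    go zero    y g = here refl , there (here refl)
    go (suc x) y g = let (a , b) = go x y (g ∘ suc) in there (there a) , there (there b)

  layer∈layersBelow : ∀ {s t} → t < s → layer t ⊑ layersBelow s
  layer∈layersBelow {suc s} {t} t<s v∈ with m≤n⇒m<n∨m≡n (s≤s⁻¹ t<s)
  ... | inj₁ t<s′ = ∈-++⁺ʳ (layer s) (layer∈layersBelow t<s′ v∈)
  ... | inj₂ refl = ∈-++⁺ˡ v∈

  thread-long : ∀ s ℓ i q → (∀ j → ℓ ≤ length (q j)) → ∀ {c} → c ∈ thread s i q → ℓ ≤ length c
  length-extend : ∀ {s} (j : Fin s) c → length (extend j c) ≡ 2 + length c

  length-extend j c = cong suc (trans (length-++ c) (+-comm (length c) 1))

  thread-long (suc s) ℓ i q ℓ≤ (here refl) = ℓ≤ _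
  thread-long (suc s) ℓ i q ℓ≤ (there c∈)  = thread-long s ℓ _ _
    (λ j → ≤-trans (ℓ≤ _) (≤-trans (m≤n+m _ 2) (≤-reflexive (sym (length-extend j (q (punchIn _ j))))))) c∈

  extend-injective : ∀ {s} (i j : Fin s) {c d} → extend i c ≡ extend j d → c ≡ d
  extend-injective i j eq = ∷ʳ-injectiveˡ _ _ (∷-injectiveʳ eq)

  -- The shortest chain of a threading tells which chain was closed first.
  thread-separated : ∀ s ℓ q → (∀ j → length (q j) ≡ ℓ) → (∀ {j k} → q j ≡ q k → j ≡ k) →
    ∀ i i′ → thread s i q ⊑ thread s i′ q → i ≡ i′
  peel-separated : ∀ s ℓ q → (∀ j → length (q j) ≡ ℓ) → (∀ {j k} → q j ≡ q k → j ≡ k) →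
    ∀ oi oi′ → peel s oi q ⊑ peel s oi′ q → oi ≡ oi′
  peel-separated s ℓ q len inj (o , i) (o′ , i′) sub = same (here-case (sub (here refl)))
    where
    longer : ∀ o i {c} → c ∈ thread s i (λ j → extend j (q (punchIn o j))) → 2 + ℓ ≤ length c
    longer o i = thread-long s (2 + ℓ) i _ (λ j → ≤-reflexive (sym (trans (length-extend j (q (punchIn o j))) (cong (2 +_) (len (punchIn o j))))))
    -- The chains that stay open gain two points at once, so nothing of the original length `ℓ` can
    -- occur among them.
    too-long : ∀ {j o i} → q j ∈ thread s i (λ j → extend j (q (punchIn o j))) → ∀ {A : Set} → A
    too-long {j} {o} {i} m = contradiction (subst (2 + ℓ ≤_) (len j) (longer o i m)) (m+n≮n 1 ℓ)
    here-case : q o ∈ peel s (o′ , i′) q → o ≡ o′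
    here-case (here eq) = inj eq
    here-case (there m) = too-long m
    same : o ≡ o′ → (o , i) ≡ (o′ , i′)
    same refl = cong (o ,_) (thread-separated s (2 + ℓ) _
      (λ j → trans (length-extend j (q (punchIn o j))) (cong (2 +_) (len (punchIn o j))))
      (λ {j} {k} eq → punchIn-injective o _ _ (inj (extend-injective j k eq)))
      i i′ (λ m → drop-here m (sub (there m))))
      where
      drop-here : ∀ {c} → c ∈ thread s i (λ j → extend j (q (punchIn o j))) →
        c ∈ peel s (o , i′) q → c ∈ thread s i′ (λ j → extend j (q (punchIn o j)))
      drop-here m (here refl) = too-long m
      drop-here m (there m′)  = m′
  thread-separated zero    ℓ q len inj zero zero sub = refl
  thread-separated (suc s) ℓ q len inj i i′ sub = begin
    i                                    ≡⟨ combine-remQuot {suc s} (s !) i ⟨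
    uncurry combine (remQuot {suc s} (s !) i)   ≡⟨ cong (uncurry combine) (peel-separated s ℓ q len inj (remQuot (s !) i) (remQuot (s !) i′) sub) ⟩
    uncurry combine (remQuot {suc s} (s !) i′)  ≡⟨ combine-remQuot {suc s} (s !) i′ ⟩
    i′                                   ∎
    where open ≡-Reasoning

  module _ {R : E → E → Set} (p : ℕ)
    (loˣ : ∀ x y → x + y < p → R (lo x y) (lo (suc x) y))
    (loʸ : ∀ x y → x + y < p → R (lo x y) (lo x (suc y)))
    (hiˣ : ∀ x y → x + y < p → R (hi (suc x) y) (hi x y))
    (hiʸ : ∀ x y → x + y < p → R (hi x (suc y)) (hi x y)) where

    run-extend : ∀ {s c} → s ≤ p → (o : Fin (suc s)) (j : Fin s) → let k = punchIn o j in
      Run R (lo (toℕ k) (height k)) (hi (toℕ k) (height k)) c →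
      Run R (lo (toℕ j) (height j)) (hi (toℕ j) (height j)) (extend j c)
    run-extend s≤p o j r = go (punchIn-step o j) r
      where
      below : toℕ j + height j < p
      below = ≤-trans (≤-reflexive (toℕ+height j)) s≤p
      go : ∀ {x y c} → (x ≡ suc (toℕ j) × y ≡ height j) ⊎ (x ≡ toℕ j × y ≡ suc (height j)) →
        Run R (lo x y) (hi x y) c → Run R (lo (toℕ j) (height j)) (hi (toℕ j) (height j)) (extend j c)
      go (inj₁ (refl , refl)) r = loˣ _ _ below ∷ snoc r (hiˣ _ _ below)
      go (inj₂ (refl , refl)) r = loʸ _ _ below ∷ snoc r (hiʸ _ _ below)

    -- The bound `x + y ≤ p` on the starting point is recorded because a grid guarantees the
    -- symmetry of the endpoints only in that region.
    run-thread : ∀ s i q → s ≤ suc p →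
      (∀ j → Run R (lo (toℕ j) (height j)) (hi (toℕ j) (height j)) (q j)) →
      ∀ {c} → c ∈ thread s i q → ∃₂ λ x y → x + y ≤ p × Run R (lo x y) (hi x y) c
    run-thread (suc s) i q s≤p r (here refl) = _ , _ , s≤s⁻¹ (≤-trans (≤-reflexive (toℕ+height o)) s≤p) , r o
      where o = proj₁ (remQuot {suc s} (s !) i)
    run-thread (suc s) i q s≤p r (there c∈) = run-thread s _ _ (m≤n⇒m≤1+n (s≤s⁻¹ s≤p))
      (λ j → run-extend (s≤s⁻¹ s≤p) (proj₁ (remQuot {suc s} (s !) i)) j (r _)) c∈

-- Symmetric chain decompositions of a grid

Covered : ∀ {n} → Subset n → Subset n → Set
Covered x y = x ⊆ y × ∣ y ∣ ≡ suc ∣ x ∣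

SymmetricRun : ∀ {n} → List (Subset n) → Set
SymmetricRun {n} c = ∃₂ λ x y → Run Covered x y c × ∣ x ∣ + ∣ y ∣ ≡ n

-- An abstract product of two chains, with the shorter side as first coordinate whichever factor it
-- comes from. `injectiveˣ` tells the cores apart, as they stand in different columns.
record Grid (n : ℕ) : Set where
  field
    p q : ℕ
    p≤q : p ≤ q
    at  : ℕ → ℕ → Subset n
    stepˣ : ∀ {x y} → x < p → y ≤ q → Covered (at x y) (at (suc x) y)
    stepʸ : ∀ {x y} → x ≤ p → y < q → Covered (at x y) (at x (suc y))
    symmetric : ∀ x y → x + y ≤ p → ∣ at x y ∣ + ∣ at (p ∸ y) (q ∸ x) ∣ ≡ n
    injectiveˣ : ∀ {x x′ y y′} → x ≤ p → x′ ≤ p → at x y ≡ at x′ y′ → x ≡ x′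

  width : ℕ
  width = suc p

  -- The mirror image of (x , y) exchanges the two coordinates, so that it fixes the columns of the cores.
  open Threading at (λ x y → at (p ∸ y) (q ∸ x)) public

  -- The part p ≤ x + y ≤ q of the column x = `toℕ j`: from y = p - x, which is `height j`, up to y
  -- = q - x. It has q - p + 1 points in every column.
  core : Fin width → List (Subset n)
  core j = applyUpTo (λ t → at (toℕ j) (t + height j)) (suc (q ∸ p))

  cover : List (Subset n)
  cover = concat (tabulate core) ++ layersBelow width

  private
    x+y≤p : ∀ j → toℕ j + height j ≡ p
    x+y≤p j = suc-injective (toℕ+height {width} j)

    step-back : ∀ {m k} → k < m → m ∸ k ≡ suc (m ∸ suc k)
    step-back {suc m} {zero}  (s≤s _) = refl
    step-back {suc m} {suc k} (s≤s h) = step-back h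

  run-core : ∀ j → Run Covered (at (toℕ j) (height j)) (at (p ∸ height j) (q ∸ toℕ j)) (core j)
  run-core j = subst₂ (λ x y → Run Covered (at (toℕ j) (height j)) (at x y) (core j)) end-x end-y
    (run-applyUpTo (λ t → at (toℕ j) (t + height j)) (q ∸ p)
      (λ t t<e → stepʸ (≤-trans (m≤m+n _ _) (≤-reflexive (x+y≤p j)))
        (≤-trans (+-mono-≤ t<e (≤-trans (m≤n+m _ _) (≤-reflexive (x+y≤p j)))) (≤-reflexive (m∸n+n≡m p≤q)))))
    where
    end-x : toℕ j ≡ p ∸ height j
    end-x = trans (sym (m+n∸n≡m (toℕ j) (height j))) (cong (_∸ height j) (x+y≤p j))
    end-y : q ∸ p + height j ≡ q ∸ toℕ j
    end-y = begin
      q ∸ p + height j                      ≡⟨ cong (λ z → q ∸ z + height j) (x+y≤p j) ⟨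
      q ∸ (toℕ j + height j) + height j     ≡⟨ cong (_+ height j) (∸-+-assoc q (toℕ j) (height j)) ⟨
      q ∸ toℕ j ∸ height j + height j       ≡⟨ m∸n+n≡m (m+n≤o⇒n≤o∸m (toℕ j) (≤-trans (≤-reflexive (x+y≤p j)) p≤q)) ⟩
      q ∸ toℕ j                             ∎
      where open ≡-Reasoning
            m+n≤o⇒n≤o∸m : ∀ m {n o} → m + n ≤ o → n ≤ o ∸ m
            m+n≤o⇒n≤o∸m m {n} h = m+n≤o⇒m≤o∸n n (≤-trans (≤-reflexive (+-comm n m)) h)

  partition : Fin (width !) → List (List (Subset n))
  partition i = thread width i core

  partition-symmetric : ∀ i {c} → c ∈ partition i → SymmetricRun c
  partition-symmetric i c∈ =
    let (x , y , x+y≤p , r) = run-thread p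
          (λ x y h → stepˣ (≤-trans (s≤s (m≤m+n x y)) h) (≤-trans (m≤n+m y x) (≤-trans (<⇒≤ h) p≤q)))
          (λ x y h → stepʸ (≤-trans (m≤m+n x y) (<⇒≤ h)) (≤-trans (s≤s (m≤n+m y x)) (≤-trans h p≤q)))
          (λ x y h → let x<q = ≤-trans (s≤s (m≤m+n x y)) (≤-trans h p≤q) in
            subst (λ z → Covered (at (p ∸ y) (q ∸ suc x)) (at (p ∸ y) z)) (sym (step-back x<q))
              (stepʸ (m∸n≤m p y) (≤-trans (≤-reflexive (sym (step-back x<q))) (m∸n≤m q x))))
          (λ x y h → let y<p = ≤-trans (s≤s (m≤n+m y x)) h in
            subst (λ z → Covered (at (p ∸ suc y) (q ∸ x)) (at z (q ∸ x))) (sym (step-back y<p))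
              (stepˣ (≤-trans (≤-reflexive (sym (step-back y<p))) (m∸n≤m p y)) (m∸n≤m q x)))
          width i core ≤-refl run-core c∈
    in _ , _ , r , symmetric x y x+y≤p

  partition-separated : ∀ i j → partition i ⊑ partition j → i ≡ j
  partition-separated = thread-separated width (suc (q ∸ p)) core
    (λ j → length-applyUpTo (λ t → at (toℕ j) (t + height j)) (suc (q ∸ p)))
    (λ {j} {k} eq → toℕ-injective (injectiveˣ (s≤s⁻¹ (toℕ<n j)) (s≤s⁻¹ (toℕ<n k)) (∷-injectiveˡ eq)))

  -- Three zones of ranks: for x + y < p the point is in a layer, for p ≤ x + y ≤ q in the core of
  -- its column, and for x + y > q it is the mirror image of (q - y , p - x), whose rank is below p.
  at∈cover : ∀ {x y} → x ≤ p → y ≤ q → at x y ∈ cover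
  at∈cover {x} {y} x≤p y≤q with x + y <? p | x + y ≤? q
  ... | yes h | _ = ∈-++⁺ʳ (concat (tabulate core)) (layer∈layersBelow (s≤s h) (proj₁ (∈-layer x y)))
  ... | no h | yes h′ = ∈-++⁺ˡ (∈-concat⁺′ in-core (∈-tabulate⁺ {f = core} j))
    where
    j = fromℕ< (s≤s x≤p)
    x≡ : toℕ j ≡ x
    x≡ = toℕ-fromℕ< (s≤s x≤p)
    p≤x+y : p ≤ x + y
    p≤x+y = ≮⇒≥ h
    height≡ : x + height j ≡ p
    height≡ = trans (cong (_+ height j) (sym x≡)) (x+y≤p j)
    height≤ : height j ≤ y
    height≤ = +-cancelˡ-≤ x _ _ (≤-trans (≤-reflexive height≡) p≤x+y)
    t< : y ∸ height j < suc (q ∸ p)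
    t< = s≤s (m+n≤o⇒m≤o∸n (y ∸ height j) (≤-trans (≤-reflexive (begin
      y ∸ height j + p              ≡⟨ cong (y ∸ height j +_) (trans (+-comm (height j) x) height≡) ⟨
      y ∸ height j + (height j + x) ≡⟨ +-assoc (y ∸ height j) (height j) x ⟨
      y ∸ height j + height j + x   ≡⟨ cong (_+ x) (m∸n+n≡m height≤) ⟩
      y + x                         ≡⟨ +-comm y x ⟩
      x + y                         ∎)) h′))
      where open ≡-Reasoning
    in-core : at x y ∈ core j
    in-core = subst (_∈ core j) (cong₂ at x≡ (m∸n+n≡m height≤)) (∈-applyUpTo⁺ (λ t → at (toℕ j) (t + height j)) t<)
  ... | no _ | no h = ∈-++⁺ʳ (concat (tabulate core)) (layer∈layersBelow (s≤s small)
      (subst (_∈ layer (suc (q ∸ y + (p ∸ x)))) (cong₂ at (m∸[m∸n]≡n x≤p) (m∸[m∸n]≡n y≤q)) (proj₂ (∈-layer (q ∸ y) (p ∸ x)))))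
    where
    small : q ∸ y + (p ∸ x) < p
    small = +-cancelʳ-< (x + y) _ _ (≤-<-trans (≤-reflexive (begin
      q ∸ y + (p ∸ x) + (x + y)     ≡⟨ regroup (q ∸ y) (p ∸ x) x y ⟩
      (q ∸ y + y) + (p ∸ x + x)     ≡⟨ cong₂ _+_ (m∸n+n≡m y≤q) (m∸n+n≡m x≤p) ⟩
      q + p                         ≡⟨ +-comm q p ⟩
      p + q                         ∎)) (+-monoʳ-< p (≰⇒> h)))
      where open ≡-Reasoning
            regroup : ∀ a b c d → a + b + (c + d) ≡ (a + d) + (b + c)
            regroup = solve-∀

  -- Combined with `at∈cover`, this count later excludes repetitions, within a grid and between
  -- grids at once.
  length-cover : length cover ≡ width * suc q
  length-cover = +-cancelʳ-≡ width _ _ (begin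
    length cover + width                                            ≡⟨ cong (_+ width) (length-++ (concat (tabulate core))) ⟩
    length (concat (tabulate core)) + length (layersBelow width) + width  ≡⟨ +-assoc (length (concat (tabulate core))) _ width ⟩
    length (concat (tabulate core)) + (length (layersBelow width) + width) ≡⟨ cong₂ _+_ (length-concat-tabulate core (λ j → length-applyUpTo (λ t → at (toℕ j) (t + height j)) (suc (q ∸ p)))) (length-layersBelow width) ⟩
    width * suc (q ∸ p) + width * width                                ≡⟨ rearrange p (q ∸ p) ⟩
    width * suc (p + (q ∸ p)) + width                                  ≡⟨ cong (λ z → width * suc z + width) (m+[n∸m]≡n p≤q) ⟩
    width * suc q + width ∎)
    where
    open ≡-Reasoning
    rearrange : ∀ p e → suc p * suc e + suc p * suc p ≡ suc p * suc (p + e) + suc p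
    rearrange = solve-∀
    length-concat-tabulate : ∀ {s ℓ} (g : Fin s → List (Subset n)) → (∀ j → length (g j) ≡ ℓ) → length (concat (tabulate g)) ≡ s * ℓ
    length-concat-tabulate {zero}  g h = refl
    length-concat-tabulate {suc s} g h = trans (length-++ (g zero)) (cong₂ _+_ (h zero) (length-concat-tabulate (g ∘ suc) (h ∘ suc)))

-- Families of partitions

-- `separated` starts from one inclusion only: this form passes easily to the parts of a member, and
-- it still distinguishes members as sets of chains.
record Family {n : ℕ} (X : List (Subset n)) (N M : ℕ) : Set where
  field
    member    : Fin M → List (List (Subset n))
    runs      : ∀ i {c} → c ∈ member i → SymmetricRun c
    covers    : ∀ i → concat (member i) ↭ X
    count     : ∀ i → length (member i) ≡ N
    separated : ∀ i j → member i ⊑ member j → i ≡ j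

gridFamily : ∀ {n} (g : Grid n) → Family (Grid.cover g) (Grid.width g) (Grid.width g !)
gridFamily g = record
  { member    = partition
  ; runs      = partition-symmetric
  ; covers    = λ i → concat-thread width i core
  ; count     = λ i → length-thread width i core
  ; separated = partition-separated
  } where open Grid g

emptyFamily : ∀ {n} → Family {n} [] 0 1
emptyFamily = record
  { member    = λ _ → []
  ; runs      = λ _ ()
  ; covers    = λ _ → ↭-refl
  ; count     = λ _ → refl
  ; separated = λ { zero zero _ → refl }
  }

unique-++-disjoint : ∀ {A : Set} {v : A} xs {ys} → Unique (xs ++ ys) → v ∈ xs → ¬ v ∈ ys
unique-++-disjoint (x ∷ xs) u       (here refl) m = Unique[x∷xs]⇒x∉xs u (∈-++⁺ʳ xs m)
unique-++-disjoint (x ∷ xs) (_ ∷ u) (there m)   m′ = unique-++-disjoint xs u m m′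

unique-++⁻ʳ : ∀ {A : Set} (xs : List A) {ys} → Unique (xs ++ ys) → Unique ys
unique-++⁻ʳ []       u       = u
unique-++⁻ʳ (x ∷ xs) (_ ∷ u) = unique-++⁻ʳ xs u

run-head : ∀ {E : Set} {R : E → E → Set} {x y c} → Run R x y c → x ∈ c
run-head [ x ]   = here refl
run-head (_ ∷ _) = here refl

-- Chains are nonempty and the two ground lists are disjoint, so a chain of a joined member reveals
-- its side. An inclusion of joined members thus splits into one on each side, and the numbers of
-- choices multiply.
unionFamily : ∀ {n} {X Y : List (Subset n)} {N N′ M M′} → Unique (X ++ Y) →
  Family X N M → Family Y N′ M′ → Family (X ++ Y) (N + N′) (M * M′)
unionFamily {n} {X} {Y} {M = M} {M′} u F G = record
  { member    = λ i → join (remQuot M′ i)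
  ; runs      = λ i c∈ → join-runs (remQuot M′ i) c∈
  ; covers    = λ i → join-covers (remQuot M′ i)
  ; count     = λ i → trans (length-++ (F.member _)) (cong₂ _+_ (F.count _) (G.count _))
  ; separated = λ i j s → trans (sym (combine-remQuot {M} M′ i))
      (trans (cong (uncurry combine) (join-separated (remQuot M′ i) (remQuot M′ j) s)) (combine-remQuot {M} M′ j))
  }
  where
  module F = Family F
  module G = Family G
  join : Fin M × Fin M′ → List (List (Subset n))
  join (i , j) = F.member i ++ G.member j
  join-runs : ∀ ij {c} → c ∈ join ij → SymmetricRun c
  join-runs (i , j) c∈ with ∈-++⁻ (F.member i) c∈
  ... | inj₁ m = F.runs i m
  ... | inj₂ m = G.runs j m
  join-covers : ∀ ij → concat (join ij) ↭ X ++ Y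
  join-covers (i , j) = subst (_↭ X ++ Y) (concat-++ (F.member i) (G.member j)) (++⁺ (F.covers i) (G.covers j))
  apart : ∀ i j {c} → c ∈ F.member i → ¬ c ∈ G.member j
  apart i j m m′ = let (_ , _ , r , _) = F.runs i m in
    unique-++-disjoint X u
      (∈-resp-↭ (F.covers i) (∈-concat⁺′ (run-head r) m))
      (∈-resp-↭ (G.covers j) (∈-concat⁺′ (run-head r) m′))
  join-separated : ∀ ij kl → join ij ⊑ join kl → ij ≡ kl
  join-separated (i , j) (k , l) s = cong₂ _,_ (F.separated i k left) (G.separated j l right)
    where
    left : F.member i ⊑ F.member k
    left m with ∈-++⁻ (F.member k) (s (∈-++⁺ˡ m))
    ... | inj₁ m′ = m′
    ... | inj₂ m′ = contradiction m′ (apart i l m)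
    right : G.member j ⊑ G.member l
    right m with ∈-++⁻ (F.member k) (s (∈-++⁺ʳ (F.member i) m))
    ... | inj₁ m′ = contradiction m (apart k j m′)
    ... | inj₂ m′ = m′

gridsFamily : ∀ {n} (gs : List (Grid n)) → Unique (concatMap Grid.cover gs) →
  Family (concatMap Grid.cover gs) (sum (map Grid.width gs)) (product (map (λ g → Grid.width g !) gs))
gridsFamily []       u = emptyFamily
gridsFamily (g ∷ gs) u = unionFamily u (gridFamily g) (gridsFamily gs (unique-++⁻ʳ (Grid.cover g) u))

-- Products of two symmetric chains

∣⊹∣ : ∀ {k m} (x : Subset k) (y : Subset m) → ∣ x ⊹ y ∣ ≡ ∣ x ∣ + ∣ y ∣
∣⊹∣ []            y = refl
∣⊹∣ (inside  ∷ x) y = cong suc (∣⊹∣ x y)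
∣⊹∣ (outside ∷ x) y = ∣⊹∣ x y

⊹-monoˡ : ∀ {k m} {x x′ : Subset k} (y : Subset m) → x ⊆ x′ → x ⊹ y ⊆ x′ ⊹ y
⊹-monoˡ {x = []}    {[]}     y s v∈ = v∈
⊹-monoˡ {x = _ ∷ _} {_ ∷ _} y s hereᵛ with s hereᵛ
... | hereᵛ = hereᵛ
⊹-monoˡ {x = _ ∷ _} {_ ∷ _} y s (thereᵛ v∈) = thereᵛ (⊹-monoˡ y (drop-∷-⊆ s) v∈)

⊹-monoʳ : ∀ {k m} (x : Subset k) {y y′ : Subset m} → y ⊆ y′ → x ⊹ y ⊆ x ⊹ y′
⊹-monoʳ []      s = s
⊹-monoʳ (b ∷ x) s = s⊆s (⊹-monoʳ x s)

record SymChain (n : ℕ) : Set where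
  field
    last      : ℕ
    at        : ℕ → Subset n
    step      : ∀ {i} → i < last → Covered (at i) (at (suc i))
    symmetric : ∣ at 0 ∣ + ∣ at last ∣ ≡ n

  size : ℕ
  size = suc last

  rank : ∀ {i} → i ≤ last → ∣ at i ∣ ≡ ∣ at 0 ∣ + i
  rank {zero}  _   = sym (+-identityʳ _)
  rank {suc i} i<l = trans (proj₂ (step i<l)) (trans (cong suc (rank (<⇒≤ i<l))) (sym (+-suc _ i)))

  at-injective : ∀ {i j} → i ≤ last → j ≤ last → at i ≡ at j → i ≡ j
  at-injective i≤ j≤ eq = +-cancelˡ-≡ ∣ at 0 ∣ _ _ (trans (sym (rank i≤)) (trans (cong ∣_∣ eq) (rank j≤)))

open SymChain

-- The shorter chain has to supply the first coordinate of the grid, but the order of the two blocks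
-- of [n] is fixed. Hence the pairing `f` is a parameter, to be `_⊹_` or its flip.
chainProduct≤ : ∀ {n k m} (c : SymChain k) (d : SymChain m) → last c ≤ last d → k + m ≡ n →
  (f : Subset k → Subset m → Subset n) →
  (∀ x y → ∣ f x y ∣ ≡ ∣ x ∣ + ∣ y ∣) →
  (∀ {x x′} y → x ⊆ x′ → f x y ⊆ f x′ y) →
  (∀ x {y y′} → y ⊆ y′ → f x y ⊆ f x y′) →
  (∀ {x x′ y y′} → f x y ≡ f x′ y′ → x ≡ x′) → Grid n
chainProduct≤ {n} {k} {m} c d c≤d k+m≡n f ∣f∣ f-monoˡ f-monoʳ f-injˡ = record
  { p = last c ; q = last d ; p≤q = c≤d
  ; at = λ x y → f (at c x) (at d y)
  ; stepˣ = λ {x} {y} x<p _ → f-monoˡ (at d y) (proj₁ (step c x<p)) ,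
      trans (∣f∣ _ _) (trans (cong (_+ ∣ at d y ∣) (proj₂ (step c x<p))) (cong suc (sym (∣f∣ _ _))))
  ; stepʸ = λ {x} {y} _ y<q → f-monoʳ (at c x) (proj₁ (step d y<q)) ,
      trans (∣f∣ _ _) (trans (cong (∣ at c x ∣ +_) (proj₂ (step d y<q))) (trans (+-suc _ _) (cong suc (sym (∣f∣ _ _)))))
  ; symmetric = λ x y x+y≤p → mirror x y (≤-trans (m≤m+n x y) x+y≤p) (≤-trans (m≤n+m y x) x+y≤p)
  ; injectiveˣ = λ x≤p x′≤p eq → at-injective c x≤p x′≤p (f-injˡ eq)
  }
  where
  -- The mirror image exchanges the coordinates, so `y` is completed to the length of the first
  -- chain and `x` to that of the second; what remains are the endpoint sums of both chains.
  regroup : ∀ a b x y u v → (a + x) + (b + y) + ((a + u) + (b + v)) ≡ (a + (a + (y + u))) + (b + (b + (x + v)))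
  regroup = solve-∀
  mirror : ∀ x y → x ≤ last c → y ≤ last c →
    ∣ f (at c x) (at d y) ∣ + ∣ f (at c (last c ∸ y)) (at d (last d ∸ x)) ∣ ≡ n
  mirror x y x≤p y≤p = begin
    ∣ f (at c x) (at d y) ∣ + ∣ f (at c (last c ∸ y)) (at d (last d ∸ x)) ∣
      ≡⟨ cong₂ _+_ (∣f∣ _ _) (∣f∣ _ _) ⟩
    ∣ at c x ∣ + ∣ at d y ∣ + (∣ at c (last c ∸ y) ∣ + ∣ at d (last d ∸ x) ∣)
      ≡⟨ cong₂ _+_ (cong₂ _+_ (rank c x≤p) (rank d (≤-trans y≤p c≤d))) (cong₂ _+_ (rank c (m∸n≤m _ y)) (rank d (m∸n≤m _ x))) ⟩
    (a + x) + (b + y) + ((a + (last c ∸ y)) + (b + (last d ∸ x)))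
      ≡⟨ regroup a b x y (last c ∸ y) (last d ∸ x) ⟩
    (a + (a + (y + (last c ∸ y)))) + (b + (b + (x + (last d ∸ x))))
      ≡⟨ cong₂ (λ u v → (a + (a + u)) + (b + (b + v))) (m+[n∸m]≡n y≤p) (m+[n∸m]≡n (≤-trans x≤p c≤d)) ⟩
    (a + (a + last c)) + (b + (b + last d))
      ≡⟨ cong₂ (λ u v → (a + u) + (b + v)) (sym (rank c ≤-refl)) (sym (rank d ≤-refl)) ⟩
    (a + ∣ at c (last c) ∣) + (b + ∣ at d (last d) ∣)
      ≡⟨ cong₂ _+_ (symmetric c) (symmetric d) ⟩
    k + m ≡⟨ k+m≡n ⟩
    n ∎
    where
    open ≡-Reasoning
    a = ∣ at c 0 ∣
    b = ∣ at d 0 ∣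

module _ {k m} (c : SymChain k) (d : SymChain m) where

  chainProductˡ : last c ≤ last d → Grid (k + m)
  chainProductˡ c≤d = chainProduct≤ c d c≤d refl _⊹_ ∣⊹∣
    ⊹-monoˡ ⊹-monoʳ (λ {x} {x′} eq → proj₁ (++-injective x x′ eq))

  chainProductʳ : last d ≤ last c → Grid (k + m)
  chainProductʳ d≤c = chainProduct≤ d c d≤c (+-comm m k)
    (λ y x → x ⊹ y) (λ y x → trans (∣⊹∣ x y) (+-comm ∣ x ∣ ∣ y ∣))
    (λ x → ⊹-monoʳ x) (λ y → ⊹-monoˡ y) (λ {y} {y′} {x} {x′} eq → proj₂ (++-injective x x′ eq))

  chainProduct : Grid (k + m)
  chainProduct with ≤-total (last c) (last d)
  ... | inj₁ c≤d = chainProductˡ c≤d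
  ... | inj₂ d≤c = chainProductʳ d≤c

  ∈-chainProduct : ∀ {i j} → i ≤ last c → j ≤ last d →
    at c i ⊹ at d j ∈ Grid.cover chainProduct
  ∈-chainProduct i≤ j≤ with ≤-total (last c) (last d)
  ... | inj₁ c≤d = Grid.at∈cover (chainProductˡ c≤d) i≤ j≤
  ... | inj₂ d≤c = Grid.at∈cover (chainProductʳ d≤c) j≤ i≤

  length-chainProduct : length (Grid.cover chainProduct) ≡ size c * size d
  length-chainProduct with ≤-total (last c) (last d)
  ... | inj₁ c≤d = Grid.length-cover (chainProductˡ c≤d)
  ... | inj₂ d≤c = trans (Grid.length-cover (chainProductʳ d≤c)) (*-comm (size d) (size c))

-- From lists of sets to indexed symmetric chains

module _ {E : Set} {R : E → E → Set} where

  runLast : ∀ {x y c} → Run R x y c → ℕ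
  runLast [ _ ]   = 0
  runLast (_ ∷ r) = suc (runLast r)

  runAt : ∀ {x y c} → Run R x y c → ℕ → E
  -- Indices past the end get the last element as a default.
  runAt [ x ]             _       = x
  runAt (_∷_ {x = x} _ _) zero    = x
  runAt (_ ∷ r)           (suc i) = runAt r i

  runAt-first : ∀ {x y c} (r : Run R x y c) → runAt r 0 ≡ x
  runAt-first [ _ ]   = refl
  runAt-first (_ ∷ _) = refl

  runAt-last : ∀ {x y c} (r : Run R x y c) → runAt r (runLast r) ≡ y
  runAt-last [ _ ]   = refl
  runAt-last (_ ∷ r) = runAt-last r

  runAt-step : ∀ {x y c} (r : Run R x y c) {i} → i < runLast r → R (runAt r i) (runAt r (suc i))
  runAt-step (_∷_ {x = x} s r) {zero}  _   = subst (R x) (sym (runAt-first r)) s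
  runAt-step (_ ∷ r) {suc i} i<l = runAt-step r (s<s⁻¹ i<l)

  length-run : ∀ {x y c} (r : Run R x y c) → length c ≡ suc (runLast r)
  length-run [ _ ]   = refl
  length-run (_ ∷ r) = cong suc (length-run r)

  lookup-run : ∀ {x y c} (r : Run R x y c) (i : Fin (length c)) → lookup c i ≡ runAt r (toℕ i)
  lookup-run [ _ ]   zero    = refl
  lookup-run (_ ∷ r) zero    = refl
  lookup-run (_ ∷ r) (suc i) = lookup-run r i

  ∈-run : ∀ {x y c v} (r : Run R x y c) → v ∈ c → ∃ λ i → i ≤ runLast r × runAt r i ≡ v
  ∈-run [ _ ]   (here eq)  = 0 , z≤n , sym eq
  ∈-run (_ ∷ r) (here eq)  = 0 , z≤n , sym eq
  ∈-run (_ ∷ r) (there v∈) = let (i , i≤ , eq) = ∈-run r v∈ in suc i , s≤s i≤ , eq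

symChain : ∀ {n} {c : List (Subset n)} → SymmetricRun c → SymChain n
symChain (x , y , r , x+y≡n) = record
  { last      = runLast r
  ; at        = runAt r
  ; step      = runAt-step r
  ; symmetric = trans (cong₂ (λ u v → ∣ u ∣ + ∣ v ∣) (runAt-first r) (runAt-last r)) x+y≡n
  }

symmetricChain : ∀ {n} {c : List (Subset n)} → SymmetricRun c → SymmetricChain c
symmetricChain {n} {c} w@(x , y , r , x+y≡n) = last s , length-run r , chain , ranks
  where
  s = symChain w
  toℕ≤ : ∀ (i : Fin (length c)) → toℕ i ≤ last s
  toℕ≤ i = s≤s⁻¹ (≤-trans (toℕ<n i) (≤-reflexive (length-run r)))
  chain : IsChain c
  chain i j i+1≡j = subst₂ _⊆_ (sym (lookup-run r i)) (trans (cong (at s) i+1≡j) (sym (lookup-run r j)))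
    (proj₁ (step s (≤-trans (≤-reflexive i+1≡j) (toℕ≤ j))))
  regroup : ∀ a i l → 2 * (a + i) + l ≡ a + (a + l) + 2 * i
  regroup = solve-∀
  ranks : ∀ i → 2 * ∣ lookup c i ∣ + last s ≡ n + 2 * toℕ i
  ranks i = begin
    2 * ∣ lookup c i ∣ + last s                       ≡⟨ cong (λ v → 2 * ∣ v ∣ + last s) (lookup-run r i) ⟩
    2 * ∣ at s (toℕ i) ∣ + last s                     ≡⟨ cong (λ v → 2 * v + last s) (rank s (toℕ≤ i)) ⟩
    2 * (∣ at s 0 ∣ + toℕ i) + last s                 ≡⟨ regroup ∣ at s 0 ∣ (toℕ i) (last s) ⟩
    ∣ at s 0 ∣ + (∣ at s 0 ∣ + last s) + 2 * toℕ i    ≡⟨ cong (λ v → ∣ at s 0 ∣ + v + 2 * toℕ i) (rank s ≤-refl) ⟨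
    ∣ at s 0 ∣ + ∣ at s (last s) ∣ + 2 * toℕ i        ≡⟨ cong (_+ 2 * toℕ i) (symmetric s) ⟩
    n + 2 * toℕ i                                     ∎
    where open ≡-Reasoning

-- The number of chains in a partition

subsets : ∀ n → List (Subset n)
subsets zero    = [] ∷ []
subsets (suc n) = map (outside ∷_) (subsets n) ++ map (inside ∷_) (subsets n)

length-subsets : ∀ n → length (subsets n) ≡ 2 ^ n
length-subsets zero    = refl
length-subsets (suc n) = begin
  length (subsets (suc n))                     ≡⟨ length-++ (map (outside ∷_) (subsets n)) ⟩
  length (map (outside ∷_) (subsets n)) + length (map (inside ∷_) (subsets n))
    ≡⟨ cong₂ _+_ (length-map _ (subsets n)) (length-map _ (subsets n)) ⟩
  length (subsets n) + length (subsets n)      ≡⟨ cong (λ z → z + z) (length-subsets n) ⟩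
  2 ^ n + 2 ^ n                                ≡⟨ cong (2 ^ n +_) (+-identityʳ (2 ^ n)) ⟨
  2 ^ suc n                                    ∎
  where open ≡-Reasoning

unique-subsets : ∀ n → Unique (subsets n)
unique-subsets zero    = [] ∷ []
unique-subsets (suc n) = unique-++⁺ (unique-map⁺ (λ { refl → refl }) (unique-subsets n))
  (unique-map⁺ (λ { refl → refl }) (unique-subsets n)) disjoint
  where
  disjoint : ∀ {v} → ¬ (v ∈ map (outside ∷_) (subsets n) × v ∈ map (inside ∷_) (subsets n))
  disjoint (a , b) with ∈-map⁻ (outside ∷_) a | ∈-map⁻ (inside ∷_) b
  ... | _ , _ , refl | _ , _ , ()

-- This turns a covering into a partition. Each entry of `us` is cut out of `xs` in turn; as `us`
-- has no repetitions, the later ones survive the cut, and the length bound leaves nothing over at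
-- the end.
unique-⊑⇒↭ : ∀ {A : Set} {us xs : List A} → Unique us → us ⊑ xs → length xs ≤ length us → us ↭ xs
unique-⊑⇒↭ {us = []} {[]} u s l = ↭-refl
unique-⊑⇒↭ {us = x ∷ us} u s l with ∈-∃++ (s (here refl))
unique-⊑⇒↭ {us = x ∷ us} u@(_ ∷ u′) s l | ys , zs , refl =
  ↭-trans (prep x (unique-⊑⇒↭ u′ s′ l′)) (↭-sym (shift x ys zs))
  where
  s′ : us ⊑ ys ++ zs
  s′ v∈ with ∈-++⁻ ys (s (there v∈))
  ... | inj₁ m            = ∈-++⁺ˡ m
  ... | inj₂ (here refl)  = contradiction v∈ (Unique[x∷xs]⇒x∉xs u)
  ... | inj₂ (there m)    = ∈-++⁺ʳ ys m
  l′ : length (ys ++ zs) ≤ length us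
  l′ = s≤s⁻¹ (≤-trans (≤-reflexive (sym (↭-length (shift x ys zs)))) l)

unique-resp-↭ : ∀ {A : Set} {xs ys : List A} → xs ↭ ys → Unique xs → Unique ys
unique-resp-↭ σ = Permutationₛ.Unique-resp-↭ (setoid _) (↭⇒↭ₛ σ)

rankCount : ∀ {n} → ℕ → List (Subset n) → ℕ
rankCount h xs = length (filter (λ x → ∣ x ∣ ≟ h) xs)

rankCount-++ : ∀ {n} h (xs ys : List (Subset n)) → rankCount h (xs ++ ys) ≡ rankCount h xs + rankCount h ys
rankCount-++ h xs ys = trans (cong length (filter-++ (λ x → ∣ x ∣ ≟ h) xs ys)) (length-++ (filter (λ x → ∣ x ∣ ≟ h) xs))

rankCount-here : ∀ {n h} (x : Subset n) xs → ∣ x ∣ ≡ h → rankCount h (x ∷ xs) ≡ suc (rankCount h xs)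
rankCount-here {h = h} x xs eq = cong length (filter-accept (λ x → ∣ x ∣ ≟ h) {x} {xs} eq)

rankCount-skip : ∀ {n h} (x : Subset n) xs → ∣ x ∣ ≢ h → rankCount h (x ∷ xs) ≡ rankCount h xs
rankCount-skip {h = h} x xs neq = cong length (filter-reject (λ x → ∣ x ∣ ≟ h) {x} {xs} neq)

rankCount-above : ∀ {n h} {x y : Subset n} {c} → Run Covered x y c → h < ∣ x ∣ → rankCount h c ≡ 0
rankCount-above [ x ]   h< = rankCount-skip x [] (>⇒≢ h<)
rankCount-above {x = x} ((_ , e) ∷ r) h< = trans (rankCount-skip x _ (>⇒≢ h<))
  (rankCount-above r (≤-trans (m≤n⇒m≤1+n h<) (≤-reflexive (sym e))))

rankCount-run : ∀ {n h} {x y : Subset n} {c} → Run Covered x y c → ∣ x ∣ ≤ h → h ≤ ∣ y ∣ → rankCount h c ≡ 1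
rankCount-run [ x ] x≤ ≤y = rankCount-here x [] (≤-antisym x≤ ≤y)
rankCount-run {x = x} ((_ , e) ∷ r) x≤ ≤y with m≤n⇒m<n∨m≡n x≤
... | inj₁ x<   = trans (rankCount-skip x _ (<⇒≢ x<)) (rankCount-run r (≤-trans (≤-reflexive e) x<) ≤y)
... | inj₂ refl = trans (rankCount-here x _ refl) (cong suc (rankCount-above r (≤-reflexive (sym e))))

run-rank-≤ : ∀ {n} {x y : Subset n} {c} → Run Covered x y c → ∣ x ∣ ≤ ∣ y ∣
run-rank-≤ [ _ ]         = ≤-refl
run-rank-≤ ((_ , e) ∷ r) = ≤-trans (<⇒≤ (≤-reflexive (sym e))) (run-rank-≤ r)

halves : ∀ {a b n} → a ≤ b → a + b ≡ n → a ≤ n / 2 × n / 2 ≤ b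
halves {a} {b} {n} a≤b refl = a≤ , ≤b
  where
  a≤ : a ≤ n / 2
  a≤ with a ≤? n / 2
  ... | yes h = h
  ... | no  h = contradiction (begin-strict
      n                       ≡⟨ m≡m%n+[m/n]*n n 2 ⟩
      n % 2 + n / 2 * 2       <⟨ +-monoˡ-< (n / 2 * 2) (m%n<n n 2) ⟩
      suc (n / 2) * 2         ≤⟨ *-monoˡ-≤ 2 (≰⇒> h) ⟩
      a * 2                   ≡⟨ *-comm a 2 ⟩
      a + (a + 0)             ≡⟨ cong (a +_) (+-identityʳ a) ⟩
      a + a                   ≤⟨ +-monoʳ-≤ a a≤b ⟩
      n                       ∎) (<-irrefl refl)
    where open ≤-Reasoning
  ≤b : n / 2 ≤ b
  ≤b with n / 2 ≤? b
  ... | yes h = h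
  ... | no  h = contradiction (begin-strict
      n                       ≤⟨ +-monoˡ-≤ b a≤b ⟩
      b + b                   ≡⟨ cong (b +_) (+-identityʳ b) ⟨
      2 * b                   ≡⟨ *-comm 2 b ⟩
      b * 2                   <⟨ *-monoˡ-< 2 (≰⇒> h) ⟩
      n / 2 * 2               ≤⟨ m/n*n≤m n 2 ⟩
      n                       ∎) (<-irrefl refl)
    where open ≤-Reasoning

-- Ranks along a run rise by one, and by `halves` its ends lie on both sides of `n / 2`: each chain
-- contributes exactly one set of that size.
rankCount-concat : ∀ {n} (cs : List (List (Subset n))) → (∀ {c} → c ∈ cs → SymmetricRun c) →
  rankCount (n / 2) (concat cs) ≡ length cs
rankCount-concat []       h = refl
rankCount-concat (c ∷ cs) h =
  let (x , y , r , x+y≡n) = h (here refl)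
      (x≤ , ≤y) = halves (run-rank-≤ r) x+y≡n
  in trans (rankCount-++ _ c (concat cs)) (cong₂ _+_ (rankCount-run r x≤ ≤y) (rankCount-concat cs (h ∘ there)))

nC0≡1 : ∀ n → n C 0 ≡ 1
nC0≡1 n = trans (nCk≡nC[n∸k] {k = 0} {n = n} z≤n) (nCn≡1 n)

rankCount-map : ∀ {n m h h′} (f : Subset n → Subset m) →
  (∀ x → ∣ x ∣ ≡ h → ∣ f x ∣ ≡ h′) → (∀ x → ∣ f x ∣ ≡ h′ → ∣ x ∣ ≡ h) →
  ∀ xs → rankCount h′ (map f xs) ≡ rankCount h xs
rankCount-map f to from [] = refl
rankCount-map {h = h} f to from (x ∷ xs) with ∣ x ∣ ≟ h
... | yes e = trans (rankCount-here (f x) _ (to x e))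
  (trans (cong suc (rankCount-map f to from xs)) (sym (rankCount-here x _ e)))
... | no ne = trans (rankCount-skip (f x) _ (ne ∘ from x))
  (trans (rankCount-map f to from xs) (sym (rankCount-skip x _ ne)))

rankCount-inside-0 : ∀ {n} (xs : List (Subset n)) → rankCount 0 (map (inside ∷_) xs) ≡ 0
rankCount-inside-0 []       = refl
rankCount-inside-0 (x ∷ xs) = rankCount-inside-0 xs

rankCount-subsets : ∀ n h → rankCount h (subsets n) ≡ n C h
rankCount-subsets zero    zero    = refl
rankCount-subsets zero    (suc h) = refl
rankCount-subsets (suc n) zero    = begin
  rankCount 0 (subsets (suc n))     ≡⟨ rankCount-++ 0 (map (outside ∷_) (subsets n)) _ ⟩
  rankCount 0 (map (outside ∷_) (subsets n)) + rankCount 0 (map (inside ∷_) (subsets n))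
    ≡⟨ cong₂ _+_ (trans (rankCount-map (outside ∷_) (λ _ e → e) (λ _ e → e) (subsets n)) (rankCount-subsets n 0)) (rankCount-inside-0 (subsets n)) ⟩
  n C 0 + 0                         ≡⟨ +-identityʳ _ ⟩
  n C 0                             ≡⟨ trans (nC0≡1 n) (sym (nC0≡1 (suc n))) ⟩
  suc n C 0                         ∎
  where open ≡-Reasoning
rankCount-subsets (suc n) (suc h) = begin
  rankCount (suc h) (subsets (suc n))     ≡⟨ rankCount-++ (suc h) (map (outside ∷_) (subsets n)) _ ⟩
  rankCount (suc h) (map (outside ∷_) (subsets n)) + rankCount (suc h) (map (inside ∷_) (subsets n))
    ≡⟨ cong₂ _+_ (trans (rankCount-map (outside ∷_) (λ _ e → e) (λ _ e → e) (subsets n)) (rankCount-subsets n (suc h)))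
                 (trans (rankCount-map (inside ∷_) (λ _ → cong suc) (λ _ → suc-injective) (subsets n)) (rankCount-subsets n h)) ⟩
  n C suc h + n C h                       ≡⟨ +-comm (n C suc h) (n C h) ⟩
  n C h + n C suc h                       ≡⟨ nCk+nC[k+1]≡[n+1]C[k+1] n h ⟩
  suc n C suc h                           ∎
  where open ≡-Reasoning

length-partition : ∀ {n} (cs : List (List (Subset n))) → (∀ {c} → c ∈ cs → SymmetricRun c) →
  concat cs ↭ subsets n → length cs ≡ n C (n / 2)
length-partition {n} cs h σ = trans (sym (rankCount-concat cs h))
  (trans (↭-length (filter-↭ (λ x → ∣ x ∣ ≟ n / 2) σ)) (rankCount-subsets n (n / 2)))

∈-subsets : ∀ {n} (x : Subset n) → x ∈ subsets n
∈-subsets []            = here refl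
∈-subsets (outside ∷ x) = ∈-++⁺ˡ (∈-map⁺ (outside ∷_) (∈-subsets x))
∈-subsets {suc n} (inside ∷ x) = ∈-++⁺ʳ (map (outside ∷_) (subsets n)) (∈-map⁺ (inside ∷_) (∈-subsets x))

-- Products of decompositions

-- What a further product uses. Disjointness is encoded numerically: the chains reach all subsets,
-- and their sizes add up to the number of subsets.
record Decomposition (n : ℕ) : Set where
  field
    chains      : List (SymChain n)
    complete    : ∀ x → ∃ λ c → c ∈ chains × ∃ λ i → i ≤ last c × at c i ≡ x
    total       : sum (map size chains) ≡ 2 ^ n
    cardinality : length chains ≡ n C (n / 2)

module _ {n : ℕ} where

  symChains : (cs : List (List (Subset n))) → (∀ {c} → c ∈ cs → SymmetricRun c) → List (SymChain n)
  symChains []       h = []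
  symChains (c ∷ cs) h = symChain (h (here refl)) ∷ symChains cs (h ∘ there)

  length-symChains : ∀ cs (h : ∀ {c} → c ∈ cs → SymmetricRun c) → length (symChains cs h) ≡ length cs
  length-symChains []       h = refl
  length-symChains (c ∷ cs) h = cong suc (length-symChains cs (h ∘ there))

  total-symChains : ∀ cs (h : ∀ {c} → c ∈ cs → SymmetricRun c) → sum (map size (symChains cs h)) ≡ length (concat cs)
  total-symChains []       h = refl
  total-symChains (c ∷ cs) h = trans
    (cong₂ _+_ (sym (length-run (proj₁ (proj₂ (proj₂ (h (here refl))))))) (total-symChains cs (h ∘ there)))
    (sym (length-++ c))

  ∈-symChains : ∀ cs (h : ∀ {c} → c ∈ cs → SymmetricRun c) {v} → v ∈ concat cs →
    ∃ λ c → c ∈ symChains cs h × ∃ λ i → i ≤ last c × at c i ≡ v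
  ∈-symChains (c ∷ cs) h v∈ with ∈-++⁻ c v∈
  ... | inj₁ m = _ , here refl , ∈-run (proj₁ (proj₂ (proj₂ (h (here refl))))) m
  ... | inj₂ m = let (d , d∈ , i) = ∈-symChains cs (h ∘ there) m in d , there d∈ , i

  decomposition : ∀ {X N M} → Family X N M → X ↭ subsets n → Fin M → Decomposition n
  decomposition F σ i = record
    { chains      = symChains (member i) (runs i)
    ; complete    = λ x → ∈-symChains (member i) (runs i) (∈-resp-↭ (↭-sym covered) (∈-subsets x))
    ; total       = trans (total-symChains (member i) (runs i)) (trans (↭-length covered) (length-subsets n))
    ; cardinality = trans (length-symChains (member i) (runs i)) (length-partition (member i) (runs i) covered)
    }
    where
    open Family F
    covered = ↭-trans (covers i) σ

module _ {k m} (P : Decomposition k) (Q : Decomposition m) where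

  open Decomposition

  grids : List (Grid (k + m))
  grids = cartesianProductWith chainProduct (chains P) (chains Q)

  length-grids : length grids ≡ (k C (k / 2)) * (m C (m / 2))
  length-grids = trans (length-cartesianProductWith chainProduct (chains P) (chains Q)) (cong₂ _*_ (cardinality P) (cardinality Q))
    where
    length-cartesianProductWith : ∀ {A B C : Set} (f : A → B → C) xs ys →
      length (cartesianProductWith f xs ys) ≡ length xs * length ys
    length-cartesianProductWith f []       ys = refl
    length-cartesianProductWith f (x ∷ xs) ys = trans (length-++ (map (f x) ys))
      (cong₂ _+_ (length-map (f x) ys) (length-cartesianProductWith f xs ys))

  length-cover-grids : length (concatMap Grid.cover grids) ≡ 2 ^ (k + m)
  length-cover-grids = begin
    length (concatMap Grid.cover grids)                              ≡⟨ go (chains P) ⟩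
    sum (map size (chains P)) * sum (map size (chains Q))            ≡⟨ cong₂ _*_ (total P) (total Q) ⟩
    2 ^ k * 2 ^ m                                                    ≡⟨ ^-distribˡ-+-* 2 k m ⟨
    2 ^ (k + m)                                                      ∎
    where
    open ≡-Reasoning
    row : ∀ c ds → length (concatMap Grid.cover (map (chainProduct c) ds)) ≡ size c * sum (map size ds)
    row c []       = sym (*-zeroʳ (size c))
    row c (d ∷ ds) = trans (length-++ (Grid.cover (chainProduct c d)))
      (trans (cong₂ _+_ (length-chainProduct c d) (row c ds)) (sym (*-distribˡ-+ (size c) (size d) _)))
    go : ∀ cs → length (concatMap Grid.cover (cartesianProductWith chainProduct cs (chains Q)))
      ≡ sum (map size cs) * sum (map size (chains Q))
    go []       = refl
    go (c ∷ cs) = begin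
      length (concatMap Grid.cover (map (chainProduct c) (chains Q) ++ rest))
        ≡⟨ cong length (concatMap-++ Grid.cover (map (chainProduct c) (chains Q)) rest) ⟩
      length (concatMap Grid.cover (map (chainProduct c) (chains Q)) ++ concatMap Grid.cover rest)
        ≡⟨ length-++ (concatMap Grid.cover (map (chainProduct c) (chains Q))) ⟩
      length (concatMap Grid.cover (map (chainProduct c) (chains Q))) + length (concatMap Grid.cover rest)
        ≡⟨ cong₂ _+_ (row c (chains Q)) (go cs) ⟩
      size c * sum (map size (chains Q)) + sum (map size cs) * sum (map size (chains Q))
        ≡⟨ *-distribʳ-+ (sum (map size (chains Q))) (size c) (sum (map size cs)) ⟨
      sum (map size (c ∷ cs)) * sum (map size (chains Q)) ∎
      where rest = cartesianProductWith chainProduct cs (chains Q)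

  ∈-cover-grids : ∀ x → x ∈ concatMap Grid.cover grids
  ∈-cover-grids x =
    let (c , c∈ , i , i≤ , eq)  = complete P (take k x)
        (d , d∈ , j , j≤ , eq′) = complete Q (drop k x)
    in ∈-concat⁺′ (subst (_∈ Grid.cover (chainProduct c d))
         (trans (cong₂ _⊹_ eq eq′) (take++drop≡id k x)) (∈-chainProduct c d i≤ j≤))
       (∈-map⁺ Grid.cover (∈-cartesianProductWith⁺ chainProduct c∈ d∈))

  cover-grids↭subsets : concatMap Grid.cover grids ↭ subsets (k + m)
  cover-grids↭subsets = ↭-sym (unique-⊑⇒↭ (unique-subsets (k + m)) (λ {x} _ → ∈-cover-grids x)
    (≤-reflexive (trans length-cover-grids (sym (length-subsets (k + m))))))

  productFamily : Family (concatMap Grid.cover grids) (sum (map Grid.width grids)) (product (map (λ g → Grid.width g !) grids))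
  productFamily = gridsFamily grids (unique-resp-↭ (↭-sym cover-grids↭subsets) (unique-subsets (k + m)))

  productPartition : ∀ i → IsSymChainPartition (k + m) (Family.member productFamily i)
  productPartition i = (λ c c∈ → symmetricChain (runs i c∈)) ,
    unique-resp-↭ (↭-sym covered) (unique-subsets _) ,
    (λ x → ∈-resp-↭ (↭-sym covered) (∈-subsets x)) ,
    length-partition (member i) (runs i) covered
    where
    open Family productFamily
    covered = ↭-trans (covers i) cover-grids↭subsets

  product-choices>0 : 0 < product (map (λ g → Grid.width g !) grids)
  product-choices>0 = go grids
    where
    go : ∀ {n} (gs : List (Grid n)) → 0 < product (map (λ g → Grid.width g !) gs)
    go []       = z<s
    go (g ∷ gs) = *-mono-< (n!>0 (Grid.width g)) (go gs)
      where n!>0 : ∀ n → 0 < n !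
            n!>0 n = >-nonZero⁻¹ (n !) {{n !≢0}}

  -- A double count of the chains of one member: grid by grid, and through the middle rank.
  -- `product-choices>0` provides the member.
  sum-widths : sum (map Grid.width grids) ≡ (k + m) C ((k + m) / 2)
  sum-widths = trans (sym (count i₀)) (proj₂ (proj₂ (proj₂ (productPartition i₀))))
    where
    open Family productFamily
    i₀ = fromℕ< product-choices>0

  productDecomposition : Decomposition (k + m)
  productDecomposition = decomposition productFamily cover-grids↭subsets (fromℕ< product-choices>0)

-- The product construction is reused to get its own factors: one element is added at a time by
-- multiplying with the two-point chain of 2^[1] and taking code 0.
someDecomposition : ∀ n → Decomposition n
someDecomposition zero = record
  { chains = record { last = 0 ; at = λ _ → [] ; step = λ () ; symmetric = refl } ∷ []
  ; complete = λ { [] → _ , here refl , 0 , z≤n , refl }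
  ; total = refl ; cardinality = refl
  }
someDecomposition (suc n) = productDecomposition two (someDecomposition n)
  where
  pt : ℕ → Subset 1
  pt zero    = outside ∷ []
  pt (suc _) = inside ∷ []
  two : Decomposition 1
  two = record
    { chains = record { last = 1 ; at = pt
                      ; step = λ { {zero} _ → (λ { (thereᵛ ()) }) , refl ; {suc _} (s≤s ()) } ; symmetric = refl } ∷ []
    ; complete = λ { (outside ∷ []) → _ , here refl , 0 , z≤n , refl ; (inside ∷ []) → _ , here refl , 1 , s≤s z≤n , refl }
    ; total = refl ; cardinality = refl
    }

-- Estimates

-- By Pascal's rule: with one copy of the first summand set aside, both remaining terms are
-- instances for a smaller `n`, and Pascal's rule recombines them.
nC[k+1]-absorb : ∀ n k → suc k * (suc n C suc k) ≡ suc n * (n C k)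
nC[k+1]-absorb zero    zero    = refl
nC[k+1]-absorb zero    (suc k) = trans (cong (suc (suc k) *_) (sym (nCk+nC[k+1]≡[n+1]C[k+1] 0 (suc k)))) (*-zeroʳ (suc (suc k)))
nC[k+1]-absorb (suc n) zero    = begin
  1 * (suc (suc n) C 1)             ≡⟨ cong (1 *_) (nCk+nC[k+1]≡[n+1]C[k+1] (suc n) 0) ⟨
  1 * (suc n C 0 + suc n C 1)       ≡⟨ cong₂ (λ u v → 1 * (u + v)) (nC0≡1 (suc n)) (trans (sym (*-identityˡ _)) (nC[k+1]-absorb n 0)) ⟩
  1 * (1 + suc n * (n C 0))         ≡⟨ cong (λ u → 1 * (1 + suc n * u)) (nC0≡1 n) ⟩
  1 * (1 + suc n * 1)               ≡⟨ unit n ⟩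
  suc (suc n) * 1                   ≡⟨ cong (suc (suc n) *_) (nC0≡1 (suc n)) ⟨
  suc (suc n) * (suc n C 0)         ∎
  where
  open ≡-Reasoning
  unit : ∀ n → 1 * (1 + suc n * 1) ≡ suc (suc n) * 1
  unit = solve-∀
nC[k+1]-absorb (suc n) (suc k) = begin
  suc (suc k) * (suc (suc n) C suc (suc k))        ≡⟨ cong (suc (suc k) *_) (nCk+nC[k+1]≡[n+1]C[k+1] (suc n) (suc k)) ⟨
  suc (suc k) * (A + B)                            ≡⟨ expand k A B ⟩
  A + (suc k * A + suc (suc k) * B)                ≡⟨ cong₂ (λ u v → A + (u + v)) (nC[k+1]-absorb n k) (nC[k+1]-absorb n (suc k)) ⟩
  A + (suc n * (n C k) + suc n * (n C suc k))      ≡⟨ cong (A +_) (*-distribˡ-+ (suc n) (n C k) (n C suc k)) ⟨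
  A + suc n * (n C k + n C suc k)                  ≡⟨ cong (λ u → A + suc n * u) (nCk+nC[k+1]≡[n+1]C[k+1] n k) ⟩
  suc (suc n) * A                                  ∎
  where
  open ≡-Reasoning
  A = suc n C suc k
  B = suc n C suc (suc k)
  expand : ∀ k a b → suc (suc k) * (a + b) ≡ a + (suc k * a + suc (suc k) * b)
  expand = solve-∀

central : ℕ → ℕ
central j = (j * 2) C j

odd-central : ∀ j → suc j * (suc (j * 2) C j) ≡ suc (j * 2) * central j
odd-central j = begin
  suc j * (suc (j * 2) C j)                   ≡⟨ cong (suc j *_) (nCk≡nC[n∸k] j≤) ⟩
  suc j * (suc (j * 2) C (suc (j * 2) ∸ j))   ≡⟨ cong (λ k → suc j * (suc (j * 2) C k)) minus ⟩
  suc j * (suc (j * 2) C suc j)               ≡⟨ nC[k+1]-absorb (j * 2) j ⟩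
  suc (j * 2) * central j                     ∎
  where
  open ≡-Reasoning
  sum≡ : ∀ j → suc (j * 2) ≡ suc j + j
  sum≡ = solve-∀
  j≤ : j ≤ suc (j * 2)
  j≤ = ≤-trans (m≤n+m j (suc j)) (≤-reflexive (sym (sum≡ j)))
  minus : suc (j * 2) ∸ j ≡ suc j
  minus = trans (cong (_∸ j) (sum≡ j)) (m+n∸n≡m (suc j) j)

central-suc : ∀ j → suc j * central (suc j) ≡ 2 * (suc (j * 2) * central j)
central-suc j = begin
  suc j * central (suc j)                     ≡⟨ nC[k+1]-absorb (suc (j * 2)) j ⟩
  suc (suc (j * 2)) * (suc (j * 2) C j)       ≡⟨ double j (suc (j * 2) C j) ⟩
  2 * (suc j * (suc (j * 2) C j))             ≡⟨ cong (2 *_) (odd-central j) ⟩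
  2 * (suc (j * 2) * central j)               ∎
  where
  open ≡-Reasoning
  double : ∀ j x → suc (suc (j * 2)) * x ≡ 2 * (suc j * x)
  double = solve-∀

-- The factor 4j + 1 fits the recurrence closely: 4 (4j + 5) (2j + 1)² exceeds 16 (4j + 1) (j + 1)²
-- by exactly 4.
central-lower : ∀ j → 16 ^ j ≤ suc (j * 4) * (central j * central j)
central-lower zero    = ≤-refl
central-lower (suc j) = *-cancelˡ-≤ (suc j * suc j) (begin
  suc j * suc j * (16 * 16 ^ j)                          ≤⟨ *-monoʳ-≤ (suc j * suc j) (*-monoʳ-≤ 16 (central-lower j)) ⟩
  suc j * suc j * (16 * (suc (j * 4) * (b * b)))         ≤⟨ m≤m+n _ (4 * (b * b)) ⟩
  suc j * suc j * (16 * (suc (j * 4) * (b * b))) + 4 * (b * b) ≡⟨ poly j b ⟩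
  suc (suc j * 4) * ((2 * (suc (j * 2) * b)) * (2 * (suc (j * 2) * b))) ≡⟨ cong (λ z → suc (suc j * 4) * (z * z)) (central-suc j) ⟨
  suc (suc j * 4) * ((suc j * b′) * (suc j * b′))        ≡⟨ poly₂ j b′ ⟩
  suc j * suc j * (suc (suc j * 4) * (b′ * b′))          ∎)
  where
  open ≤-Reasoning
  b  = central j
  b′ = central (suc j)
  poly : ∀ j b → suc j * suc j * (16 * (suc (j * 4) * (b * b))) + 4 * (b * b)
    ≡ suc (suc j * 4) * ((2 * (suc (j * 2) * b)) * (2 * (suc (j * 2) * b)))
  poly = solve-∀
  poly₂ : ∀ j c → suc (suc j * 4) * ((suc j * c) * (suc j * c)) ≡ suc j * suc j * (suc (suc j * 4) * (c * c))
  poly₂ = solve-∀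

-- The induction step rests on (2j + 1) (2j + 3) + 1 = 4 (j + 1)².
central-upper : ∀ j → suc (j * 2) * (central j * central j) ≤ 16 ^ j
central-upper zero    = ≤-refl
central-upper (suc j) = *-cancelˡ-≤ (suc j * suc j) (begin
  suc j * suc j * (suc (suc j * 2) * (b′ * b′))          ≡⟨ poly₂ j b′ ⟩
  suc (suc j * 2) * ((suc j * b′) * (suc j * b′))        ≡⟨ cong (λ z → suc (suc j * 2) * (z * z)) (central-suc j) ⟩
  suc (suc j * 2) * ((2 * (suc (j * 2) * b)) * (2 * (suc (j * 2) * b))) ≤⟨ m≤m+n _ (4 * (suc (j * 2) * (b * b))) ⟩
  suc (suc j * 2) * ((2 * (suc (j * 2) * b)) * (2 * (suc (j * 2) * b))) + 4 * (suc (j * 2) * (b * b)) ≡⟨ poly j b ⟩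
  suc j * suc j * (16 * (suc (j * 2) * (b * b)))         ≤⟨ *-monoʳ-≤ (suc j * suc j) (*-monoʳ-≤ 16 (central-upper j)) ⟩
  suc j * suc j * (16 * 16 ^ j)                          ∎)
  where
  open ≤-Reasoning
  b  = central j
  b′ = central (suc j)
  poly : ∀ j b → suc (suc j * 2) * ((2 * (suc (j * 2) * b)) * (2 * (suc (j * 2) * b))) + 4 * (suc (j * 2) * (b * b))
    ≡ suc j * suc j * (16 * (suc (j * 2) * (b * b)))
  poly = solve-∀
  poly₂ : ∀ j c → suc j * suc j * (suc (suc j * 2) * (c * c)) ≡ suc (suc j * 2) * ((suc j * c) * (suc j * c))
  poly₂ = solve-∀

even⊎odd : ∀ n → (n ≡ n / 2 * 2) ⊎ (n ≡ suc (n / 2 * 2))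
even⊎odd n with n % 2 | m≡m%n+[m/n]*n n 2 | m%n<n n 2
... | 0 | e | _ = inj₁ e
... | 1 | e | _ = inj₂ e
... | suc (suc _) | _ | s≤s (s≤s ())

4^[j*2]≡16^j : ∀ j → 4 ^ (j * 2) ≡ 16 ^ j
4^[j*2]≡16^j j = trans (cong (4 ^_) (*-comm j 2)) (sym (^-*-assoc 4 2 j))

middle : ℕ → ℕ
middle n = n C (n / 2)

nCk≤[n+1]Ck : ∀ n k → n C k ≤ suc n C k
nCk≤[n+1]Ck n zero    = ≤-reflexive (trans (nC0≡1 n) (sym (nC0≡1 (suc n))))
nCk≤[n+1]Ck n (suc k) = ≤-trans (m≤n+m (n C suc k) (n C k)) (≤-reflexive (nCk+nC[k+1]≡[n+1]C[k+1] n k))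

odd-central≤ : ∀ j → suc (j * 2) C j ≤ 2 * central j
odd-central≤ j = *-cancelˡ-≤ (suc j) (begin
  suc j * (suc (j * 2) C j)           ≡⟨ odd-central j ⟩
  suc (j * 2) * central j             ≤⟨ m≤n+m _ (central j) ⟩
  central j + suc (j * 2) * central j ≡⟨ double j (central j) ⟩
  suc j * (2 * central j)             ∎)
  where
  open ≤-Reasoning
  double : ∀ j x → x + suc (j * 2) * x ≡ suc j * (2 * x)
  double = solve-∀

middle-upper : ∀ n → n * (middle n * middle n) ≤ 4 ^ n
middle-upper n with even⊎odd n
... | inj₁ e = subst (λ m → m * ((m C (n / 2)) * (m C (n / 2))) ≤ 4 ^ m) (sym e) (begin
    j * 2 * (central j * central j)         ≤⟨ m≤n+m _ (central j * central j) ⟩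
    suc (j * 2) * (central j * central j)   ≤⟨ central-upper j ⟩
    16 ^ j                                  ≡⟨ 4^[j*2]≡16^j j ⟨
    4 ^ (j * 2)                             ∎)
  where open ≤-Reasoning
        j = n / 2
... | inj₂ e = subst (λ m → m * ((m C (n / 2)) * (m C (n / 2))) ≤ 4 ^ m) (sym e) (begin
    suc (j * 2) * ((suc (j * 2) C j) * (suc (j * 2) C j)) ≤⟨ *-monoʳ-≤ (suc (j * 2)) (*-mono-≤ (odd-central≤ j) (odd-central≤ j)) ⟩
    suc (j * 2) * (2 * central j * (2 * central j))       ≡⟨ pull j (central j) ⟩
    4 * (suc (j * 2) * (central j * central j))           ≤⟨ *-monoʳ-≤ 4 (central-upper j) ⟩
    4 * 16 ^ j                                            ≡⟨ cong (4 *_) (4^[j*2]≡16^j j) ⟨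
    4 ^ suc (j * 2)                                       ∎)
  where open ≤-Reasoning
        j = n / 2
        pull : ∀ j x → suc (j * 2) * (2 * x * (2 * x)) ≡ 4 * (suc (j * 2) * (x * x))
        pull = solve-∀

middle-lower : ∀ n .{{_ : NonZero n}} → 4 ^ n ≤ 8 * n * (middle n * middle n)
middle-lower n with even⊎odd n
... | inj₁ e = subst (λ m → 4 ^ m ≤ 8 * m * ((m C (n / 2)) * (m C (n / 2)))) (sym e) (begin
    4 ^ (j * 2)                             ≡⟨ 4^[j*2]≡16^j j ⟩
    16 ^ j                                  ≤⟨ central-lower j ⟩
    suc (j * 4) * (central j * central j)   ≤⟨ *-monoˡ-≤ (central j * central j) bound ⟩
    8 * (j * 2) * (central j * central j)   ∎)
  where
  open ≤-Reasoning
  j = n / 2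
  split : ∀ j → j * 4 + j * 12 ≡ 8 * (j * 2)
  split = solve-∀
  -- Here `n` ≠ 0 enters: 4j + 1 ≤ 16j fails for j = 0.
  j≢0 : 0 < j
  j≢0 = n≢0⇒n>0 λ j≡0 → ≢-nonZero⁻¹ n (trans e (cong (_* 2) j≡0))
  bound : suc (j * 4) ≤ 8 * (j * 2)
  bound = ≤-trans (≤-trans (≤-reflexive (+-comm 1 (j * 4))) (+-monoʳ-≤ (j * 4) (≤-trans j≢0 (m≤m*n j 12)))) (≤-reflexive (split j))
... | inj₂ e = subst (λ m → 4 ^ m ≤ 8 * m * ((m C (n / 2)) * (m C (n / 2)))) (sym e) (begin
    4 * 4 ^ (j * 2)                                ≡⟨ cong (4 *_) (4^[j*2]≡16^j j) ⟩
    4 * 16 ^ j                                     ≤⟨ *-monoʳ-≤ 4 (central-lower j) ⟩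
    4 * (suc (j * 4) * (central j * central j))    ≤⟨ m≤m+n _ (4 * (central j * central j)) ⟩
    4 * (suc (j * 4) * (central j * central j)) + 4 * (central j * central j) ≡⟨ poly j (central j) ⟩
    8 * suc (j * 2) * (central j * central j)      ≤⟨ *-monoʳ-≤ (8 * suc (j * 2)) (*-mono-≤ (nCk≤[n+1]Ck (j * 2) j) (nCk≤[n+1]Ck (j * 2) j)) ⟩
    8 * suc (j * 2) * ((suc (j * 2) C j) * (suc (j * 2) C j)) ∎)
  where
  open ≤-Reasoning
  j = n / 2
  poly : ∀ j x → 4 * (suc (j * 4) * (x * x)) + 4 * (x * x) ≡ 8 * suc (j * 2) * (x * x)
  poly = solve-∀

n<[1+⌊√n⌋]² : ∀ n → n < suc ⌊√ n ⌋ * suc ⌊√ n ⌋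
n<[1+⌊√n⌋]² n = go n (m≤m*n (suc n) (suc n))
  where
  -- Invariant of the downward search: `suc s` is already too large for a root.
  go : ∀ s → n < suc s * suc s → n < suc (isqrtFrom s n) * suc (isqrtFrom s n)
  go zero    h = h
  go (suc s) h with (suc s * suc s) ≤ᵇ n in eq
  ... | true  = h
  ... | false = go s (≰⇒> λ le → subst T eq (≤⇒≤ᵇ le))

2^⌊log₂n⌋≤n : ∀ n → 0 < n → 2 ^ ⌊log₂ n ⌋ ≤ n
2^⌊log₂n⌋≤n = <-rec (λ n → 0 < n → 2 ^ ⌊log₂ n ⌋ ≤ n) go
  where
  go : ∀ n → (∀ {m} → m < n → 0 < m → 2 ^ ⌊log₂ m ⌋ ≤ m) → 0 < n → 2 ^ ⌊log₂ n ⌋ ≤ n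
  go 1 rec _ = ≤-refl
  go n@(suc (suc m)) rec _ = begin
    2 ^ ⌊log₂ n ⌋                    ≡⟨ cong (2 ^_) (m+[n∸m]≡n {1} (⌊log₂⌋-mono-≤ {2} {n} (s≤s (s≤s z≤n)))) ⟨
    2 * 2 ^ (⌊log₂ n ⌋ ∸ 1)          ≡⟨ cong (λ l → 2 * 2 ^ l) (⌊log₂⌊n/2⌋⌋≡⌊log₂n⌋∸1 n) ⟨
    2 * 2 ^ ⌊log₂ ⌊ n /2⌋ ⌋          ≤⟨ *-monoʳ-≤ 2 (rec (⌊n/2⌋<n (suc m)) z<s) ⟩
    2 * ⌊ n /2⌋                      ≡⟨ cong (⌊ n /2⌋ +_) (+-identityʳ ⌊ n /2⌋) ⟩
    ⌊ n /2⌋ + ⌊ n /2⌋                ≤⟨ +-monoʳ-≤ ⌊ n /2⌋ (⌊n/2⌋≤⌈n/2⌉ n) ⟩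
    ⌊ n /2⌋ + ⌈ n /2⌉                ≡⟨ ⌊n/2⌋+⌈n/2⌉≡n n ⟩
    n                                ∎
    where open ≤-Reasoning

n*n≤m*m⇒n≤m : ∀ {m n} → n * n ≤ m * m → n ≤ m
n*n≤m*m⇒n≤m {m} {n} h = ≮⇒≥ λ m<n → contradiction h (<⇒≱ (*-mono-< m<n m<n))

-- All but t of the factors of a ! exceed t.
t^[a∸t]≤a! : ∀ t .{{_ : NonZero t}} a → t ^ (a ∸ t) ≤ a !
t^[a∸t]≤a! t zero    = ≤-reflexive (cong (t ^_) (0∸n≡0 t))
t^[a∸t]≤a! t (suc a) with t ≤? a
... | yes t≤a = begin
  t ^ (suc a ∸ t)       ≡⟨ cong (t ^_) (+-∸-assoc 1 t≤a) ⟩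
  t * t ^ (a ∸ t)       ≤⟨ *-mono-≤ (m≤n⇒m≤1+n t≤a) (t^[a∸t]≤a! t a) ⟩
  suc a * a !           ∎
  where open ≤-Reasoning
... | no t≰a = ≤-trans (≤-reflexive (cong (t ^_) (m≤n⇒m∸n≡0 (≰⇒> t≰a)))) (>-nonZero⁻¹ (suc a !) {{suc a !≢0}})

module _ {A : Set} (a : A → ℕ) (t : ℕ) .{{_ : NonZero t}} where

  -- Truncation lets grids narrower than `t` contribute nothing, and each entry loses at most `t`
  -- against `a x`, hence the loss of `t` times the number of grids.
  excess : List A → ℕ
  excess xs = sum (map (λ x → a x ∸ t) xs)

  sum≤excess : ∀ xs → sum (map a xs) ≤ t * length xs + excess xs
  sum≤excess []       = z≤n
  sum≤excess (x ∷ xs) = begin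
    a x + sum (map a xs)                           ≤⟨ +-mono-≤ (m≤n+m∸n (a x) t) (sum≤excess xs) ⟩
    t + (a x ∸ t) + (t * length xs + excess xs)    ≡⟨ regroup t (a x ∸ t) (length xs) (excess xs) ⟩
    t * length (x ∷ xs) + excess (x ∷ xs)          ∎
    where
    open ≤-Reasoning
    regroup : ∀ t y l e → t + y + (t * l + e) ≡ t * suc l + (y + e)
    regroup = solve-∀

  t^excess≤product! : ∀ xs → t ^ excess xs ≤ product (map (λ x → a x !) xs)
  t^excess≤product! []       = ≤-refl
  t^excess≤product! (x ∷ xs) = ≤-trans (≤-reflexive (^-distribˡ-+-* t (a x ∸ t) (excess xs)))
    (*-mono-≤ (t^[a∸t]≤a! t (a x)) (t^excess≤product! xs))

2^k≤n⇒k≤⌊log₂n⌋ : ∀ k {n} → 2 ^ k ≤ n → k ≤ ⌊log₂ n ⌋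
2^k≤n⇒k≤⌊log₂n⌋ k h = ≤-trans (≤-reflexive (sym (⌊log₂[2^n]⌋≡n k))) (⌊log₂⌋-mono-≤ h)

-- Choice of the parameters and the final count

module _ (n : ℕ) (n₀≤n : 2 ^ 16 ≤ n) where

  private
    0<n : 0 < n
    0<n = ≤-trans (m^n>0 2 16) n₀≤n

    instance
      n≢0 : NonZero n
      n≢0 = >-nonZero 0<n

    L = ⌊log₂ n ⌋
    -- So `t` is about n^(1/4): well below the average width, which is of order √n, while log t is
    -- still a constant fraction of log n.
    w = L / 4
    t = 2 ^ w
    h = n / 2
    m = n ∸ h
    N = middle n
    s = ⌊√ n ⌋

    instance
      t≢0 : NonZero t
      t≢0 = m^n≢0 2 w

    16≤L : 16 ≤ L
    16≤L = 2^k≤n⇒k≤⌊log₂n⌋ 16 n₀≤n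

    4w≤L : w * 4 ≤ L
    4w≤L = m/n*n≤m L 4

    -- Rounding gives L ≤ 4w + 3; in the doubled inequality the surplus 6 is absorbed by one `L`.
    L≤8w : L ≤ 8 * w
    L≤8w = +-cancelʳ-≤ L _ _ (begin
      L + L                       ≡⟨ cong (λ z → z + z) (m≡m%n+[m/n]*n L 4) ⟩
      (L % 4 + w * 4) + (L % 4 + w * 4) ≤⟨ +-mono-≤ r≤ r≤ ⟩
      (3 + w * 4) + (3 + w * 4)   ≡⟨ regroup w ⟩
      8 * w + 6                   ≤⟨ +-monoʳ-≤ (8 * w) (≤-trans (m≤m+n 6 10) 16≤L) ⟩
      8 * w + L                   ∎)
      where
      open ≤-Reasoning
      r≤ : L % 4 + w * 4 ≤ 3 + w * 4
      r≤ = +-monoˡ-≤ (w * 4) (s≤s⁻¹ (m%n<n L 4))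
      regroup : ∀ w → (3 + w * 4) + (3 + w * 4) ≡ 8 * w + 6
      regroup = solve-∀

    -- The threshold 2^16 is made for this: 8 + 2w ≤ L is half of 16 + 4w ≤ 2L.
    256t²≤n : 256 * (t * t) ≤ n
    256t²≤n = begin
      256 * (t * t)               ≡⟨ cong (256 *_) (^-distribˡ-+-* 2 w w) ⟨
      2 ^ 8 * 2 ^ (w + w)         ≡⟨ ^-distribˡ-+-* 2 8 (w + w) ⟨
      2 ^ (8 + (w + w))           ≤⟨ ^-monoʳ-≤ 2 8+2w≤L ⟩
      2 ^ L                       ≤⟨ 2^⌊log₂n⌋≤n n 0<n ⟩
      n                           ∎
      where
      open ≤-Reasoning
      regroup : ∀ w → 2 * (8 + (w + w)) ≡ 16 + w * 4
      regroup = solve-∀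
      8+2w≤L : 8 + (w + w) ≤ L
      8+2w≤L = *-cancelˡ-≤ 2 (begin
        2 * (8 + (w + w))         ≡⟨ regroup w ⟩
        16 + w * 4                ≤⟨ +-mono-≤ 16≤L 4w≤L ⟩
        L + L                     ≡⟨ cong (L +_) (+-identityʳ L) ⟨
        2 * L                     ∎)

    h+m≡n : h + m ≡ n
    h+m≡n = m+[n∸m]≡n (m/n≤m n 2)

    G = middle h * middle m

    n≤3h : n ≤ 3 * h
    n≤3h = begin
      n                 ≡⟨ m≡m%n+[m/n]*n n 2 ⟩
      n % 2 + h * 2     ≤⟨ +-monoˡ-≤ (h * 2) (≤-trans (s≤s⁻¹ (m%n<n n 2)) 1≤h) ⟩
      h + h * 2         ≡⟨ cong (h +_) (*-comm h 2) ⟩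
      3 * h             ∎
      where
      open ≤-Reasoning
      1≤h : 1 ≤ h
      1≤h = m≥n⇒m/n>0 (≤-trans (^-monoʳ-≤ 2 {1} {16} (s≤s z≤n)) n₀≤n)

    n≤2m : n ≤ 2 * m
    n≤2m = begin
      n                 ≡⟨ h+m≡n ⟨
      h + m             ≤⟨ +-monoˡ-≤ m (m+n≤o⇒m≤o∸n h (≤-trans (≤-reflexive (h+h h)) (m/n*n≤m n 2))) ⟩
      m + m             ≡⟨ cong (m +_) (+-identityʳ m) ⟨
      2 * m             ∎
      where
      open ≤-Reasoning
      h+h : ∀ h → h + h ≡ h * 2
      h+h = solve-∀

    -- The average width N / G is at least of order √n. The constant is 3 · 2 · 8, from `n≤3h`,
    -- `n≤2m` and `middle-lower`.
    nG²≤48N² : n * (G * G) ≤ 48 * (N * N)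
    nG²≤48N² = *-cancelˡ-≤ n (begin
      n * (n * (G * G))                 ≡⟨ *-assoc n n (G * G) ⟨
      n * n * (G * G)                   ≤⟨ *-monoˡ-≤ (G * G) (*-mono-≤ n≤3h n≤2m) ⟩
      3 * h * (2 * m) * (G * G)         ≡⟨ regroup h m (middle h) (middle m) ⟩
      6 * (h * (middle h * middle h) * (m * (middle m * middle m)))
                                        ≤⟨ *-monoʳ-≤ 6 (*-mono-≤ (middle-upper h) (middle-upper m)) ⟩
      6 * (4 ^ h * 4 ^ m)               ≡⟨ cong (6 *_) (^-distribˡ-+-* 4 h m) ⟨
      6 * 4 ^ (h + m)                   ≡⟨ cong (λ k → 6 * 4 ^ k) h+m≡n ⟩
      6 * 4 ^ n                         ≤⟨ *-monoʳ-≤ 6 (middle-lower n) ⟩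
      6 * (8 * n * (N * N))             ≡⟨ regroup₂ n N ⟩
      n * (48 * (N * N))                ∎)
      where
      open ≤-Reasoning
      regroup : ∀ h m x y → 3 * h * (2 * m) * (x * y * (x * y)) ≡ 6 * (h * (x * x) * (m * (y * y)))
      regroup = solve-∀
      regroup₂ : ∀ n z → 6 * (8 * n * (z * z)) ≡ n * (48 * (z * z))
      regroup₂ = solve-∀

    2tG≤N : 2 * (t * G) ≤ N
    2tG≤N = n*n≤m*m⇒n≤m (*-cancelˡ-≤ 48 (begin
      48 * (2 * (t * G) * (2 * (t * G)))  ≡⟨ regroup t G ⟩
      -- 192 = 48 · 4 is rounded up to the power of two 256.
      192 * (t * t) * (G * G)             ≤⟨ *-monoˡ-≤ (G * G) (≤-trans (*-monoˡ-≤ (t * t) (m≤m+n 192 64)) 256t²≤n) ⟩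
      n * (G * G)                         ≤⟨ nG²≤48N² ⟩
      48 * (N * N)                        ∎))
      where
      open ≤-Reasoning
      regroup : ∀ t g → 48 * (2 * (t * g) * (2 * (t * g))) ≡ 192 * (t * t) * (g * g)
      regroup = solve-∀

    0<s : 0 < s
    0<s = n≢0⇒n>0 λ s≡0 → contradiction (subst (λ z → n < suc z * suc z) s≡0 (n<[1+⌊√n⌋]² n))
      (≤⇒≯ 0<n)

    n≤4s² : n ≤ 4 * (s * s)
    n≤4s² = begin
      n                   ≤⟨ <⇒≤ (n<[1+⌊√n⌋]² n) ⟩
      suc s * suc s       ≤⟨ *-mono-≤ (+-monoˡ-≤ s 0<s) (+-monoˡ-≤ s 0<s) ⟩
      (s + s) * (s + s)   ≡⟨ regroup s ⟩
      4 * (s * s)         ∎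
      where
      open ≤-Reasoning
      regroup : ∀ s → (s + s) * (s + s) ≡ 4 * (s * s)
      regroup = solve-∀

    -- Squared, the constant is 8 · 4 = 32, from `middle-lower` and `n≤4s²`, rounded up to 36.
    2^n≤6sN : 2 ^ n ≤ 6 * (s * N)
    2^n≤6sN = n*n≤m*m⇒n≤m (begin
      2 ^ n * 2 ^ n                     ≡⟨ ^-distribˡ-+-* 2 n n ⟨
      2 ^ (n + n)                       ≡⟨ cong (λ k → 2 ^ (n + k)) (+-identityʳ n) ⟨
      2 ^ (2 * n)                       ≡⟨ ^-*-assoc 2 2 n ⟨
      4 ^ n                             ≤⟨ middle-lower n ⟩
      8 * n * (N * N)                   ≤⟨ *-monoˡ-≤ (N * N) (*-monoʳ-≤ 8 n≤4s²) ⟩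
      8 * (4 * (s * s)) * (N * N)       ≤⟨ m≤m+n _ (4 * (s * s * (N * N))) ⟩
      8 * (4 * (s * s)) * (N * N) + 4 * (s * s * (N * N)) ≡⟨ regroup s N ⟩
      6 * (s * N) * (6 * (s * N))       ∎)
      where
      open ≤-Reasoning
      regroup : ∀ s z → 8 * (4 * (s * s)) * (z * z) + 4 * (s * s * (z * z)) ≡ 6 * (s * z) * (6 * (s * z))
      regroup = solve-∀

    P : Decomposition h
    P = someDecomposition h

    Q : Decomposition m
    Q = someDecomposition m

    gs = grids P Q
    M = product (map (λ g → Grid.width g !) gs)
    E = excess Grid.width t gs

    N≤2E : N ≤ 2 * E
    N≤2E = +-cancelˡ-≤ N _ _ (begin
      N + N                                     ≡⟨ cong (N +_) (+-identityʳ N) ⟨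
      2 * N                                     ≡⟨ cong (2 *_) (trans (sum-widths P Q) (cong middle h+m≡n)) ⟨
      2 * sum (map Grid.width gs)               ≤⟨ *-monoʳ-≤ 2 (sum≤excess Grid.width t gs) ⟩
      2 * (t * length gs + E)                   ≡⟨ *-distribˡ-+ 2 (t * length gs) E ⟩
      2 * (t * length gs) + 2 * E               ≡⟨ cong (λ z → 2 * (t * z) + 2 * E) (length-grids P Q) ⟩
      2 * (t * G) + 2 * E                       ≤⟨ +-monoˡ-≤ (2 * E) 2tG≤N ⟩
      N + 2 * E                                 ∎)
      where open ≤-Reasoning

    -- 96 = 6 · 2 · 8 collects the losses of `2^n≤6sN`, `N≤2E` and `L≤8w`; its inverse is the
    -- constant c.
    exponent : 1 * 2 ^ n * L ≤ w * E * (96 * s)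
    exponent = begin
      1 * 2 ^ n * L                 ≡⟨ cong (_* L) (*-identityˡ (2 ^ n)) ⟩
      2 ^ n * L                     ≤⟨ *-mono-≤ 2^n≤6sN L≤8w ⟩
      6 * (s * N) * (8 * w)         ≤⟨ *-monoˡ-≤ (8 * w) (*-monoʳ-≤ 6 (*-monoʳ-≤ s N≤2E)) ⟩
      6 * (s * (2 * E)) * (8 * w)   ≡⟨ regroup s E w ⟩
      w * E * (96 * s)              ∎
      where
      open ≤-Reasoning
      regroup : ∀ s e w → 6 * (s * (2 * e)) * (8 * w) ≡ w * e * (96 * s)
      regroup = solve-∀

    many : 2 ^ (1 * 2 ^ n * L) ≤ M ^ (96 * s)
    many = begin
      2 ^ (1 * 2 ^ n * L)           ≤⟨ ^-monoʳ-≤ 2 exponent ⟩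
      2 ^ (w * E * (96 * s))        ≡⟨ ^-*-assoc 2 (w * E) (96 * s) ⟨
      (2 ^ (w * E)) ^ (96 * s)      ≡⟨ cong (_^ (96 * s)) (^-*-assoc 2 w E) ⟨
      (t ^ E) ^ (96 * s)            ≤⟨ ^-monoˡ-≤ (96 * s) (t^excess≤product! Grid.width t gs) ⟩
      M ^ (96 * s)                  ∎
      where open ≤-Reasoning

  -- Raising the number of partitions to the power 96 ⌊√n⌋ clears both the fraction c = 1/96 and the
  -- division by √n, so that the bound is stated in natural numbers.
  manyPartitions : ∃[ M ] ((2 ^ (1 * 2 ^ n * ⌊log₂ n ⌋) ≤ M ^ (96 * ⌊√ n ⌋)) ×
    Σ (Fin M → List (List (Subset n))) λ P →
    ((i : Fin M) → IsSymChainPartition n (P i)) ×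
    ((i j : Fin M) → i ≢ j → ¬ SamePartition (P i) (P j)))
  manyPartitions = M , many ,
    -- The partitions are built over `h + m`, the length of a concatenation, and carried over to
    -- `n`. Of the equivalence `same` one direction feeds `separated`.
    subst (λ n → Σ (Fin M → List (List (Subset n))) λ P →
      ((i : Fin M) → IsSymChainPartition n (P i)) ×
      ((i j : Fin M) → i ≢ j → ¬ SamePartition (P i) (P j))) h+m≡n
      (member , productPartition P Q , λ i j i≢j same → i≢j (separated i j (λ {c} → Equivalence.to (same c))))
    where open Family (productFamily P Q)

theorem1p5 : ∃[ p ] ∃[ q ] (0 < p × 0 < q × ∃[ n₀ ] ((n : ℕ) → n₀ ≤ n →
    ∃[ M ] ((2 ^ (p * 2 ^ n * ⌊log₂ n ⌋) ≤ M ^ (q * ⌊√ n ⌋)) ×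
    Σ (Fin M → List (List (Subset n))) λ P →
    ((i : Fin M) → IsSymChainPartition n (P i)) ×
    ((i j : Fin M) → i ≢ j → ¬ SamePartition (P i) (P j)))))
theorem1p5 = 1 , 96 , z<s , z<s , 2 ^ 16 , manyPartitions
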